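{- For every relational structure $\mathfrak M=(\Sigma;R_1,\dots,R_m)$, the monadic second-order chain theory $MSO^{ch}(\mathcal S_{\mathfrak M})$ of the structure $\mathcal S_{\mathfrak M}=(\Sigma^*;EqLength,\preceq,A_{R_1},\dots,A_{R_m},A_=)$ is (effectively) reducible to the first-order theory of $\mathfrak M$.
   Context: $\mathcal S_{\mathfrak M}$ has domain $\Sigma^*$ with: $EqLength(x,y)$ iff $|x|=|y|$; $x\preceq y$ iff $x$ is a prefix of $y$; for $R_i$ of arity $n$, $A_{R_i}(x_1,\dots,x_n)$ iff there are $w_1,\dots,w_n\in\Sigma^*$ all of the same length and $a_1,\dots,a_n\in\Sigma$ with $x_j=w_ja_j$ for all $j$ and $(a_1,\dots,a_n)\in R_i^{\mathfrak M}$; $A_=(x,y)$ iff $x,y$ are nonempty, of the same length and have the same last letter. The monadic second-order chain logic of a structure equipped with a partial order (here $\preceq$) is the fragment of monadic second-order logic in which set variables range only over chains, i.e. subsets linearly ordered by the partial order; $MSO^{ch}(\mathcal S_{\mathfrak M})$ is the set of sentences of this logic true in $\mathcal S_{\mathfrak M}$. -}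

module Defs where

open import Level using (Level; Lift; suc)
open import Data.Empty.Polymorphic using (⊥)
open import Data.Fin.Base using (Fin)
open import Data.List.Base using (List; length; last; _∷ʳ_)
open import Data.List.Relation.Binary.Pointwise using (Pointwise-≡⇒≡; ≡⇒Pointwise-≡)
open import Data.List.Relation.Binary.Prefix.Heterogeneous using (Prefix)
import Data.List.Relation.Binary.Prefix.Homogeneous.Properties as Prefixₚ
open import Data.Maybe.Base using (just)
open import Data.Nat.Base using (ℕ)
open import Data.Product.Base using (Σ-syntax; ∃-syntax; _×_)
open import Data.Sum.Base using (_⊎_)
open import Data.Vec.Base using (Vec; []; _∷_; lookup; map; zipWith)
open import Relation.Binary.Core using (Rel)
open import Relation.Binary.PropositionalEquality using (_≡_; isEquivalence; isPartialOrder)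
open import Relation.Binary.Structures using (IsPartialOrder)
open import Relation.Nullary.Negation.Core using (¬_)
open import Relation.Unary using (Pred)

private
  variable
    ℓ : Level
    n k : ℕ

record Signature : Set₁ where
  field
    Symbol : Set
    arity  : Symbol → ℕ

open Signature

record Structure (σ : Signature) (ℓ : Level) : Set (suc ℓ) where
  field
    Carrier : Set ℓ
    rel     : (s : Symbol σ) → Pred (Vec Carrier (arity σ s)) ℓ

record OrderedStructure (σ : Signature) (ℓ : Level) : Set (suc ℓ) where
  field
    structure : Structure σ ℓ
  open Structure structure public
  field
    _⊑_            : Rel Carrier ℓ
    ⊑-partialOrder : IsPartialOrder _≡_ _⊑_

  IsChain : Pred (Pred Carrier ℓ) ℓ
  IsChain X = ∀ x y → X x → X y → x ⊑ y ⊎ y ⊑ x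

-- Formulas are well scoped, with de Bruijn indices: the variable bound
-- last is  zero.

module _ (σ : Signature) where

  -- First-order formulas with equality and  n  free variables.
  data FO (n : ℕ) : Set where
    atom        : (s : Symbol σ) → Vec (Fin n) (arity σ s) → FO n
    _≐_         : Fin n → Fin n → FO n
    false       : FO n
    not         : FO n → FO n
    _∧_ _∨_ _⇒_ : FO n → FO n → FO n
    all ex      : FO (ℕ.suc n) → FO n

  -- Monadic second-order formulas with  n  free element variables and
  --  k  free set variables.
  data MSO (n k : ℕ) : Set where
    atom        : (s : Symbol σ) → Vec (Fin n) (arity σ s) → MSO n k
    _≐_         : Fin n → Fin n → MSO n k
    _∈ˢ_        : Fin n → Fin k → MSO n k
    false       : MSO n k
    not         : MSO n k → MSO n k
    _∧_ _∨_ _⇒_ : MSO n k → MSO n k → MSO n k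
    all₁ ex₁    : MSO (ℕ.suc n) k → MSO n k
    all₂ ex₂    : MSO n (ℕ.suc k) → MSO n k

  FOSentence : Set
  FOSentence = FO 0

  MSOSentence : Set
  MSOSentence = MSO 0 0

module _ {σ : Signature} {ℓ : Level} (𝔐 : Structure σ ℓ) where
  open Structure 𝔐 using (Carrier) renaming (rel to ⟦_⟧)

  SatFO : Vec Carrier n → FO σ n → Set ℓ
  SatFO ρ (atom s is) = ⟦ s ⟧ (map (lookup ρ) is)
  SatFO ρ (i ≐ j)     = lookup ρ i ≡ lookup ρ j
  SatFO ρ false       = ⊥
  SatFO ρ (not φ)     = ¬ SatFO ρ φ
  SatFO ρ (φ ∧ ψ)     = SatFO ρ φ × SatFO ρ ψ
  SatFO ρ (φ ∨ ψ)     = SatFO ρ φ ⊎ SatFO ρ ψ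
  SatFO ρ (φ ⇒ ψ)     = SatFO ρ φ → SatFO ρ ψ
  SatFO ρ (all φ)     = (a : Carrier) → SatFO (a ∷ ρ) φ
  SatFO ρ (ex φ)      = Σ[ a ∈ Carrier ] SatFO (a ∷ ρ) φ

  FOTheory : Pred (FOSentence σ) ℓ
  FOTheory φ = SatFO [] φ

module _ {σ : Signature} {ℓ : Level} (𝔄 : OrderedStructure σ ℓ) where
  open OrderedStructure 𝔄 using (Carrier; IsChain) renaming (rel to ⟦_⟧)

  -- Chain semantics: only the set quantifiers differ from full MSO.
  SatCh : Vec Carrier n → Vec (Pred Carrier ℓ) k → MSO σ n k → Set (suc ℓ)
  SatCh ρ η (atom s is) = Lift (suc ℓ) (⟦ s ⟧ (map (lookup ρ) is))
  SatCh ρ η (i ≐ j)     = Lift (suc ℓ) (lookup ρ i ≡ lookup ρ j)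
  SatCh ρ η (i ∈ˢ j)    = Lift (suc ℓ) (lookup η j (lookup ρ i))
  SatCh ρ η false       = ⊥
  SatCh ρ η (not φ)     = ¬ SatCh ρ η φ
  SatCh ρ η (φ ∧ ψ)     = SatCh ρ η φ × SatCh ρ η ψ
  SatCh ρ η (φ ∨ ψ)     = SatCh ρ η φ ⊎ SatCh ρ η ψ
  SatCh ρ η (φ ⇒ ψ)     = SatCh ρ η φ → SatCh ρ η ψ
  SatCh ρ η (all₁ φ)    = (a : Carrier) → SatCh (a ∷ ρ) η φ
  SatCh ρ η (ex₁ φ)     = Σ[ a ∈ Carrier ] SatCh (a ∷ ρ) η φ
  SatCh ρ η (all₂ φ)    = (X : Pred Carrier ℓ) → IsChain X → SatCh ρ (X ∷ η) φ
  SatCh ρ η (ex₂ φ)     = Σ[ X ∈ Pred Carrier ℓ ] IsChain X × SatCh ρ (X ∷ η) φ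

  MSOChTheory : Pred (MSOSentence σ) (suc ℓ)
  MSOChTheory φ = SatCh [] [] φ

-- The signature of 𝔐 = (Σ; R₁, …, Rₘ), where Rᵢ has arity  ar i.
relSig : (m : ℕ) → (Fin m → ℕ) → Signature
relSig m ar = record { Symbol = Fin m ; arity = ar }

data WordSymbol (A : Set) : Set where
  eqLength prefix lastEq : WordSymbol A
  lastRel                : A → WordSymbol A

-- The signature of 𝒮 𝔐; lastEq is A₌ and lastRel R is A_R.
wordSig : Signature → Signature
wordSig σ = record { Symbol = WordSymbol (Symbol σ) ; arity = ar }
  where
  ar : WordSymbol (Symbol σ) → ℕ
  ar eqLength    = 2
  ar prefix      = 2
  ar lastEq      = 2
  ar (lastRel R) = arity σ R

module _ {A : Set ℓ} where

  _≼_ : Rel (List A) ℓ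
  _≼_ = Prefix _≡_

  ≼-partialOrder : IsPartialOrder _≡_ _≼_
  ≼-partialOrder = record
    { isPreorder = record
      { isEquivalence = isEquivalence
      ; reflexive     = λ x≡y → P.reflexive (≡⇒Pointwise-≡ x≡y)
      ; trans         = P.trans
      }
    ; antisym = λ x≼y y≼x → Pointwise-≡⇒≡ (P.antisym x≼y y≼x)
    }
    where module P = IsPartialOrder (Prefixₚ.isPartialOrder (isPartialOrder {A = A}))

𝒮 : {σ : Signature} → Structure σ ℓ → OrderedStructure (wordSig σ) ℓ
𝒮 {ℓ} {σ} 𝔐 = record
  { structure      = record { Carrier = List Carrier ; rel = ⟦_⟧ }
  ; _⊑_            = _≼_
  ; ⊑-partialOrder = ≼-partialOrder
  }
  where
  open Structure 𝔐
  ⟦_⟧ : (s : Symbol (wordSig σ)) → Pred (Vec (List Carrier) (arity (wordSig σ) s)) ℓ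
  ⟦ eqLength ⟧ (x ∷ y ∷ []) = Lift ℓ (length x ≡ length y)
  ⟦ prefix ⟧   (x ∷ y ∷ []) = x ≼ y
  -- A common last letter  just a  forces both words to be nonempty.
  ⟦ lastEq ⟧   (x ∷ y ∷ []) =
    length x ≡ length y × (∃[ a ] last x ≡ just a × last y ≡ just a)
  ⟦ lastRel R ⟧ xs =
    ∃[ ws ] ∃[ as ]
      (∀ i j → length (lookup ws i) ≡ length (lookup ws j))
      × xs ≡ zipWith _∷ʳ_ ws as
      × rel R as

{-# OPTIONS --safe #-}

-- A chain consists of prefixes of a single finite or infinite word, so it is
-- coded by an ω-word whose letters are a mark together with an optional element
-- of Σ; a word is coded likewise, with one mark at its end.  A formula with t free
-- variables thus defines a language of ω-words over t-tuples of such cells.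
-- Each of these languages is recognised, in the sense of Büchi, by a finite
-- semigroup with a set of accepting linked pairs (s , e), where moreover the
-- tuples with a given value in the semigroup are first-order definable in 𝔐.
-- Negation complements the accepting pairs, conjunction is the product, and
-- existential quantification is the powerset semigroup, whose letter values are
-- definable by quantifying over one more element of 𝔐.  Without free variables
-- only one letter is left: its value is pinned down by first-order sentences, and
-- for each possible value acceptance can be computed from an idempotent power.

module Submission where

open import Defs
open import Level using (Level; Lift; lift; lower)
open import Axiom.ExcludedMiddle using (ExcludedMiddle)
open import Data.Bool.Base using (Bool; true; false; if_then_else_)
open import Data.Empty.Polymorphic using (⊥; ⊥-elim)
open import Data.Fin.Base using (Fin; zero; suc; toℕ; combine; remQuot; finToFun; funToFin)
open import Data.Fin.Properties using
  (remQuot-combine; combine-remQuot; finToFun-funToFin; funToFin-finToFin; any?; pigeonhole)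
  renaming (_≟_ to _≟ᶠ_)
open import Data.List.Base using (List; []; _∷_; length; null; last; _∷ʳ_)
open import Data.List.Properties using (length-++)
open import Data.List.Relation.Binary.Prefix.Heterogeneous using ([]; _∷_)
open import Data.Maybe.Base as Maybe using (Maybe; just; nothing)
open import Data.Maybe.Properties using (just-injective)
open import Data.Nat.Base using
  (ℕ; zero; suc; _+_; _*_; _∸_; _^_; _⊔_; _≤_; _<_; _≤′_; ≤′-refl; ≤′-step; z≤n; s≤s; z<s)
open import Data.Nat.Properties as ℕₚ using
  (_≟_; _<?_; <-cmp; ≤-refl; ≤-trans; <-trans; <-≤-trans; ≤-<-trans; <-irrefl; n<1+n;
   m≤m⊔n; m≤n⊔m; ≤⇒≤′; ≮⇒≥; <⇒≱)
open import Data.Product.Base as Product using (Σ-syntax; ∃; ∃-syntax; ∃₂; _×_; _,_; proj₁; proj₂)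
open import Data.Sum.Base as Sum using (_⊎_; inj₁; inj₂)
open import Data.Unit.Base using (⊤; tt)
open import Data.Vec.Base using (Vec; []; _∷_; lookup; map; zipWith; tabulate)
open import Data.Vec.Properties using
  (lookup-map; lookup-zipWith; lookup∘tabulate; tabulate∘lookup; tabulate-cong;
   map-cong; map-∘; ∷-injective)
open import Function.Base using (_∘_; id; const)
open import Function.Bundles using (_⇔_; mk⇔; Equivalence)
open import Function.Construct.Composition using (_⇔-∘_)
open import Function.Construct.Symmetry using (⇔-sym)
open import Relation.Binary.Definitions using (tri<; tri≈; tri>)
open import Relation.Binary.PropositionalEquality using
  (_≡_; _≢_; refl; sym; trans; cong; cong₂; subst; module ≡-Reasoning)
open import Relation.Binary.Structures using (IsPartialOrder)
open import Relation.Nullary.Decidable using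
  (Dec; yes; no; does; ¬?; _×-dec_; map′; decidable-stable)
open import Relation.Nullary.Negation.Core using (¬_; contradiction)
open import Relation.Unary using (Pred; Decidable; _∈_)

open Equivalence using (to; from)
open Signature

-- Finite semigroups, products over intervals and Ramsey factorisations.

record FinSemigroup : Set where
  infixr 7 _∙_
  field
    size  : ℕ
    _∙_   : Fin size → Fin size → Fin size
    assoc : ∀ x y z → (x ∙ y) ∙ z ≡ x ∙ (y ∙ z)

  Elem : Set
  Elem = Fin size

module _ (S : FinSemigroup) where
  open FinSemigroup S

  -- The product of  f  over the half-open interval from  i  to  j.
  data Prod (f : ℕ → Elem) : ℕ → ℕ → Elem → Set where
    [_] : ∀ i → Prod f i (suc i) (f i)
    _∷_ : ∀ i {j s} → Prod f (suc i) j s → Prod f i j (f i ∙ s)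

  -- Ramsey factorisations, with a linked pair (s , e) as their type.
  record Factorisation (f : ℕ → Elem) (s e : Elem) : Set where
    field
      cut    : ℕ → ℕ
      head   : Prod f 0 (cut 0) s
      tail   : ∀ i → Prod f (cut i) (cut (suc i)) e
      idem   : e ∙ e ≡ e
      absorb : s ∙ e ≡ s

module _ {S : FinSemigroup} where
  open FinSemigroup S

  private
    variable
      f g   : ℕ → Elem
      i j k : ℕ
      s t   : Elem

  Prod-< : Prod S f i j s → i < j
  Prod-< [ i ]   = n<1+n i
  Prod-< (i ∷ p) = <-trans (n<1+n i) (Prod-< p)

  Prod-++ : Prod S f i j s → Prod S f j k t → Prod S f i k (s ∙ t)
  Prod-++ [ i ]   q = i ∷ q
  Prod-++ (i ∷ p) q = subst (Prod S _ i _) (sym (assoc _ _ _)) (i ∷ Prod-++ p q)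

  -- The endpoints dictate the derivation: where the two disagree, one of them would contain a
  -- product over an empty interval, contrary to `Prod-<`.
  Prod-unique : Prod S f i j s → Prod S f i j t → s ≡ t
  Prod-unique [ i ]   [ .i ]   = refl
  Prod-unique [ i ]   (.i ∷ q) = contradiction (Prod-< q) (<-irrefl refl)
  Prod-unique (i ∷ p) [ .i ]   = contradiction (Prod-< p) (<-irrefl refl)
  Prod-unique (i ∷ p) (.i ∷ q) = cong (_ ∙_) (Prod-unique p q)

  Prod-cong : (∀ n → i ≤ n → n < j → f n ≡ g n) → Prod S f i j s → Prod S g i j s
  Prod-cong {g = g} f≗g [ i ]   =
    subst (Prod S g i _) (sym (f≗g i ≤-refl ≤-refl)) [ i ]
  Prod-cong {g = g} f≗g (i ∷ p) =
    subst (λ x → Prod S g i _ (x ∙ _)) (sym (f≗g i ≤-refl (<-trans (n<1+n i) (Prod-< p))))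
      (i ∷ Prod-cong (λ n i<n → f≗g n (≤-trans (ℕₚ.n≤1+n i) i<n)) p)

  Prod-total : ∀ f {i j} → i < j → ∃ (Prod S f i j)
  Prod-total f i<j = go (≤⇒≤′ i<j)
    where
    go : suc i ≤′ j → ∃ (Prod S f i j)
    go ≤′-refl                 = _ , [ _ ]
    go (≤′-step {n = n} i<n)   = _ , Prod-++ (proj₂ (go i<n)) [ n ]

  module _ {s e : Elem} (F : Factorisation S f s e) where
    open Factorisation F

    -- The linked-pair equations make the value independent of the cut: `absorb` swallows each
    -- further factor here, and `idem` merges adjacent factors in `factor-value`.
    prefix-value : ∀ i → Prod S f 0 (cut i) s
    prefix-value zero    = head
    prefix-value (suc i) = subst (Prod S f 0 _) absorb (Prod-++ (prefix-value i) (tail i))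

    factor-value : i < j → Prod S f (cut i) (cut j) e
    factor-value i<j = go (≤⇒≤′ i<j)
      where
      go : suc i ≤′ j → Prod S f (cut i) (cut j) e
      go ≤′-refl             = tail _
      go (≤′-step {n = n} p) = subst (Prod S f _ _) idem (Prod-++ (go p) (tail n))

module _ {S T : FinSemigroup} where
  private
    module S = FinSemigroup S
    module T = FinSemigroup T

  module _ (θ : S.Elem → T.Elem) (homo : ∀ x y → θ (x S.∙ y) ≡ θ x T.∙ θ y) where

    Prod-map : ∀ {f i j s} → Prod S f i j s → Prod T (θ ∘ f) i j (θ s)
    Prod-map [ i ]   = [ i ]
    Prod-map (i ∷ p) = subst (Prod T _ i _) (sym (homo _ _)) (i ∷ Prod-map p)

    Factorisation-map : ∀ {f s e} → Factorisation S f s e → Factorisation T (θ ∘ f) (θ s) (θ e)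
    Factorisation-map F = record
      { cut    = cut
      ; head   = Prod-map head
      ; tail   = λ i → Prod-map (tail i)
      ; idem   = trans (sym (homo _ _)) (cong θ idem)
      ; absorb = trans (sym (homo _ _)) (cong θ absorb)
      }
      where open Factorisation F

Factorisation-cong : ∀ {S f g s e} → (∀ n → f n ≡ g n) →
                     Factorisation S f s e → Factorisation S g s e
Factorisation-cong f≗g F = record
  { cut    = cut
  ; head   = Prod-cong (λ n _ _ → f≗g n) head
  ; tail   = λ i → Prod-cong (λ n _ _ → f≗g n) (tail i)
  ; idem   = idem
  ; absorb = absorb
  }
  where open Factorisation F

-- Strictly increasing sequences

StrictlyIncreasing : (ℕ → ℕ) → Set
StrictlyIncreasing c = ∀ i → c i < c (suc i)

module _ {c : ℕ → ℕ} (c↑ : StrictlyIncreasing c) where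

  mono-≤ : ∀ {i j} → i ≤ j → c i ≤ c j
  mono-≤ i≤j = go (≤⇒≤′ i≤j)
    where
    go : ∀ {i j} → i ≤′ j → c i ≤ c j
    go ≤′-refl             = ≤-refl
    go (≤′-step {n = n} p) = ≤-trans (go p) (ℕₚ.<⇒≤ (c↑ n))

  mono-< : ∀ {i j} → i < j → c i < c j
  mono-< {i} i<j = <-≤-trans (c↑ i) (mono-≤ i<j)

  module _ (0<c : 0 < c 0) where

    id<c : ∀ n → n < c n
    id<c zero    = 0<c
    id<c (suc n) = ≤-<-trans (id<c n) (c↑ n)

    -- Locates a position among the factors of a factorisation with cuts `c`: index `0` is the head
    -- before `c 0`, and index `suc i` is the factor from `c i` to `c (suc i)`. The search descends
    -- from `b = n`, which is large enough by `id<c`.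
    block : ∀ n → ∃[ b ] n < c b × (∀ {i} → i < b → c i ≤ n)
    block n = go n (id<c n)
      where
      go : ∀ b → n < c b → ∃[ b ] n < c b × (∀ {i} → i < b → c i ≤ n)
      go zero    n<c = zero , n<c , λ ()
      go (suc b) n<c with n <? c b
      ... | yes n<cb = go b n<cb
      ... | no  n≮cb = suc b , n<c ,
        λ { (s≤s i≤b) → ≤-trans (mono-≤ i≤b) (≮⇒≥ n≮cb) }

    block-zero : ∀ {n} → n < c 0 → proj₁ (block n) ≡ 0
    block-zero {n} n<c with block n
    ... | zero  , _        = refl
    ... | suc b , _ , c≤n = contradiction (c≤n (s≤s z≤n)) (<⇒≱ n<c)

    block-suc : ∀ {n i} → c i ≤ n → n < c (suc i) → proj₁ (block n) ≡ suc i
    block-suc {n} {i} ci≤n n<c with block n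
    ... | b , n<cb , c≤n with <-cmp b (suc i)
    ...   | tri< (s≤s b≤i) _ _ = contradiction (≤-trans (mono-≤ b≤i) ci≤n) (<⇒≱ n<cb)
    ...   | tri≈ _ b≡ _        = b≡
    ...   | tri> _ _ i<b       = contradiction (c≤n i<b) (<⇒≱ n<c)

-- Ramsey's theorem for pairs

Unbounded : (ℕ → Set) → Set
Unbounded A = ∀ n → ∃[ m ] n ≤ m × A m

-- Finitely many bounds have a maximum.
Fin-bound : ∀ {N} (P : Fin N → ℕ → Set) → (∀ e → ∃[ n ] ∀ m → n ≤ m → ¬ P e m) →
            ∃[ n ] ∀ e m → n ≤ m → ¬ P e m
Fin-bound {zero}  P b = 0 , λ ()
Fin-bound {suc N} P b with b zero | Fin-bound (P ∘ suc) (b ∘ suc)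
... | n , ¬P₀ | n′ , ¬Pₛ = n ⊔ n′ , λ
  { zero    m le → ¬P₀ m (≤-trans (m≤m⊔n n n′) le)
  ; (suc e) m le → ¬Pₛ e m (≤-trans (m≤n⊔m n n′) le)
  }

module _ (em : ExcludedMiddle Level.zero) where

  ¬Unbounded⇒bounded : ∀ {A} → ¬ Unbounded A → ∃[ n ] ∀ m → n ≤ m → ¬ A m
  ¬Unbounded⇒bounded {A} ¬unb with em {∃[ n ] ∀ m → n ≤ m → ¬ A m}
  ... | yes b = b
  ... | no ¬b = contradiction unb ¬unb
    where
    unb : Unbounded A
    unb n with em {∃[ m ] n ≤ m × A m}
    ... | yes p = p
    ... | no ¬p = contradiction (n , λ m n≤m a → ¬p (m , n≤m , a)) ¬b

  -- If each colour occurred only boundedly often, `Fin-bound` would give a common bound, and a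
  -- point of `A` beyond it would have no colour.
  infinite-pigeonhole : ∀ {N A} (R : ℕ → Fin N → Set) → Unbounded A →
    (∀ m → A m → ∃ (R m)) → ∃[ e ] Unbounded (λ m → A m × R m e)
  infinite-pigeonhole {N} {A} R unb total with em {∃[ e ] Unbounded (λ m → A m × R m e)}
  ... | yes p = p
  ... | no ¬p
    with n , none ← Fin-bound (λ e m → A m × R m e)
                      (λ e → ¬Unbounded⇒bounded (λ u → ¬p (e , u)))
    with m , n≤m , a ← unb n
    with e , r ← total m a
    = contradiction (a , r) (none e m n≤m)

  -- Each stage fixes the least point of an infinite set and shrinks the set to
  -- later points receiving a single colour against it.
  ramsey : ∀ {N} (R : ℕ → ℕ → Fin N → Set) → (∀ {i j} → i < j → ∃ (R i j)) →
    ∃₂ λ g e → StrictlyIncreasing g × (∀ {i j} → i < j → R (g i) (g j) e)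
  ramsey {N} R total = g , e , g↑ , homogeneous
    where
    Stage : Set₁
    Stage = Σ[ A ∈ (ℕ → Set) ] Unbounded A

    point : Stage → ℕ
    point (A , unb) = proj₁ (unb 0)

    After : Stage → ℕ → Set
    After (A , unb) m = A m × point (A , unb) < m

    shrink : (st : Stage) → ∃[ e ] Unbounded (λ m → After st m × R (point st) m e)
    shrink st@(A , unb) = infinite-pigeonhole (R (point st))
      -- The maximum with `suc (point st)` keeps the new point strictly after the current one.
      (λ n → let m , le , a = unb (n ⊔ suc (point st)) in
             m , ≤-trans (m≤m⊔n n _) le , a , ≤-trans (m≤n⊔m n _) le)
      (λ m am → total (proj₂ am))

    stage : ℕ → Stage
    stage zero    = (λ _ → ⊤) , λ n → n , ≤-refl , tt
    stage (suc i) = _ , proj₂ (shrink (stage i))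

    a : ℕ → ℕ
    a i = point (stage i)

    colour : ℕ → Fin N
    colour i = proj₁ (shrink (stage i))

    -- The stages are nested, so every element of stage `j` keeps the colour that it received
    -- against each earlier point.
    later : ∀ {i j} → suc i ≤′ j → ∀ m → proj₁ (stage j) m → a i < m × R (a i) m (colour i)
    later ≤′-refl     m ((_ , lt) , r)  = lt , r
    later (≤′-step p) m ((Am , _) , _)  = later p m Am

    later-point : ∀ {i j} → i < j → a i < a j × R (a i) (a j) (colour i)
    later-point {i} {j} i<j = later (≤⇒≤′ i<j) (a j) (proj₂ (proj₂ (proj₂ (stage j) 0)))

    -- So far the colour of a pair depends on its smaller point. A second use of the pigeonhole
    -- principle selects infinitely many stages with one colour.
    frequent : ∃[ e ] Unbounded (λ i → ⊤ × colour i ≡ e)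
    frequent = infinite-pigeonhole (λ i e → colour i ≡ e)
      (λ n → n , ≤-refl , tt) (λ i _ → colour i , refl)

    e : Fin N
    e = proj₁ frequent

    next : ℕ → ℕ
    next n = proj₁ (proj₂ frequent n)

    sub : ℕ → ℕ
    sub zero    = next 0
    sub (suc i) = next (suc (sub i))

    sub-colour : ∀ i → colour (sub i) ≡ e
    sub-colour zero    = proj₂ (proj₂ (proj₂ (proj₂ frequent 0)))
    sub-colour (suc i) = proj₂ (proj₂ (proj₂ (proj₂ frequent (suc (sub i)))))

    sub↑ : StrictlyIncreasing sub
    sub↑ i = proj₁ (proj₂ (proj₂ frequent (suc (sub i))))

    g : ℕ → ℕ
    g = a ∘ sub

    g↑ : StrictlyIncreasing g
    g↑ i = proj₁ (later-point (sub↑ i))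

    homogeneous : ∀ {i j} → i < j → R (g i) (g j) e
    homogeneous {i} {j} i<j =
      subst (R (g i) (g j)) (sub-colour i) (proj₂ (later-point (mono-< sub↑ i<j)))

-- Subsets of Fin N as elements of Fin (2 ^ N)

funToFin-cong : ∀ {m n} {f g : Fin m → Fin n} → (∀ i → f i ≡ g i) → funToFin f ≡ funToFin g
funToFin-cong {zero}  f≗g = refl
funToFin-cong {suc m} f≗g = cong₂ combine (f≗g zero) (funToFin-cong (f≗g ∘ suc))

module _ {N : ℕ} where

  infix 4 _∋_ _∋?_

  _∋_ : Fin (2 ^ N) → Fin N → Set
  U ∋ s = finToFun U s ≡ suc zero

  _∋?_ : ∀ U s → Dec (U ∋ s)
  U ∋? s = finToFun U s ≟ᶠ suc zero

  indicator : ∀ {p} {P : Set p} → Dec P → Fin 2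
  indicator P? = if does P? then suc zero else zero

  ⟪_⟫ : ∀ {p} {P : Pred (Fin N) p} → Decidable P → Fin (2 ^ N)
  ⟪ P? ⟫ = funToFin (λ s → indicator (P? s))

  indicator-⇔ : ∀ {p} {P : Set p} (P? : Dec P) → indicator P? ≡ suc zero ⇔ P
  indicator-⇔ (yes p) = mk⇔ (λ _ → p) (λ _ → refl)
  indicator-⇔ (no ¬p) = mk⇔ (λ ()) (λ p → contradiction p ¬p)

  ∋-⟪⟫ : ∀ {p} {P : Pred (Fin N) p} (P? : Decidable P) s → ⟪ P? ⟫ ∋ s ⇔ P s
  ∋-⟪⟫ P? s = subst (λ b → b ≡ suc zero ⇔ _)
    (sym (finToFun-funToFin (λ s → indicator (P? s)) s)) (indicator-⇔ (P? s))

  ∋-ext : ∀ {U V : Fin (2 ^ N)} → (∀ s → U ∋ s ⇔ V ∋ s) → U ≡ V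
  ∋-ext {U} {V} U⇔V = begin
    U                        ≡⟨ sym (funToFin-finToFin {N} {2} U) ⟩
    funToFin {N} (finToFun U) ≡⟨ funToFin-cong (λ s → two (U⇔V s)) ⟩
    funToFin {N} (finToFun V) ≡⟨ funToFin-finToFin {N} {2} V ⟩
    V                        ∎
    where
    open ≡-Reasoning
    two : ∀ {x y : Fin 2} → x ≡ suc zero ⇔ y ≡ suc zero → x ≡ y
    two {zero}     {zero}     _ = refl
    two {zero}     {suc zero} h = from h refl
    two {suc zero} {y}        h = sym (to h refl)

-- Products, powersets and transformations

_⊗_ : FinSemigroup → FinSemigroup → FinSemigroup
S ⊗ T = record { size = S.size * T.size ; _∙_ = _∙_ ; assoc = assoc }
  where
  module S = FinSemigroup S
  module T = FinSemigroup T

  _∙_ : Fin (S.size * T.size) → Fin (S.size * T.size) → Fin (S.size * T.size)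
  x ∙ y = let x₁ , x₂ = remQuot T.size x ; y₁ , y₂ = remQuot T.size y in
          combine (x₁ S.∙ y₁) (x₂ T.∙ y₂)

  assoc : ∀ x y z → (x ∙ y) ∙ z ≡ x ∙ (y ∙ z)
  assoc x y z =
    let x₁ , x₂ = remQuot T.size x ; y₁ , y₂ = remQuot T.size y
        z₁ , z₂ = remQuot T.size z in begin
    (x ∙ y) ∙ z
      ≡⟨ cong (λ p → combine (proj₁ p S.∙ z₁) (proj₂ p T.∙ z₂)) (remQuot-combine _ _) ⟩
    combine ((x₁ S.∙ y₁) S.∙ z₁) ((x₂ T.∙ y₂) T.∙ z₂)
      ≡⟨ cong₂ combine (S.assoc x₁ y₁ z₁) (T.assoc x₂ y₂ z₂) ⟩
    combine (x₁ S.∙ (y₁ S.∙ z₁)) (x₂ T.∙ (y₂ T.∙ z₂))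
      ≡⟨ cong (λ p → combine (x₁ S.∙ proj₁ p) (x₂ T.∙ proj₂ p)) (sym (remQuot-combine _ _)) ⟩
    x ∙ (y ∙ z) ∎
    where open ≡-Reasoning

𝒫 : FinSemigroup → FinSemigroup
𝒫 S = record { size = 2 ^ size ; _∙_ = _⊙_ ; assoc = assoc′ }
  module Powerset where
  open FinSemigroup S

  product? : ∀ U V s → Dec (∃₂ λ u v → U ∋ u × V ∋ v × u ∙ v ≡ s)
  product? U V s = any? λ u → any? λ v → (U ∋? u) ×-dec (V ∋? v) ×-dec (u ∙ v ≟ᶠ s)

  _⊙_ : Fin (2 ^ size) → Fin (2 ^ size) → Fin (2 ^ size)
  U ⊙ V = ⟪ product? U V ⟫

  ∋-⊙ : ∀ U V s → U ⊙ V ∋ s ⇔ (∃₂ λ u v → U ∋ u × V ∋ v × u ∙ v ≡ s)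
  ∋-⊙ U V s = ∋-⟪⟫ (product? U V) s

  ∙-∋-⊙ : ∀ U V {u v} → U ∋ u → V ∋ v → U ⊙ V ∋ (u ∙ v)
  ∙-∋-⊙ U V u∈ v∈ = from (∋-⊙ U V _) (_ , _ , u∈ , v∈ , refl)

  assoc′ : ∀ U V W → (U ⊙ V) ⊙ W ≡ U ⊙ (V ⊙ W)
  assoc′ U V W = ∋-ext λ s → mk⇔ (ltr s) (rtl s)
    where
    ltr : ∀ s → (U ⊙ V) ⊙ W ∋ s → U ⊙ (V ⊙ W) ∋ s
    ltr s s∈ with x , w , x∈ , w∈ , refl ← to (∋-⊙ (U ⊙ V) W s) s∈
             with u , v , u∈ , v∈ , refl ← to (∋-⊙ U V x) x∈
      = subst (U ⊙ (V ⊙ W) ∋_) (sym (assoc u v w))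
          (∙-∋-⊙ U (V ⊙ W) u∈ (∙-∋-⊙ V W v∈ w∈))
    rtl : ∀ s → U ⊙ (V ⊙ W) ∋ s → (U ⊙ V) ⊙ W ∋ s
    rtl s s∈ with u , x , u∈ , x∈ , refl ← to (∋-⊙ U (V ⊙ W) s) s∈
             with v , w , v∈ , w∈ , refl ← to (∋-⊙ V W x) x∈
      = subst ((U ⊙ V) ⊙ W ∋_) (assoc u v w)
          (∙-∋-⊙ (U ⊙ V) W (∙-∋-⊙ U V u∈ v∈) w∈)

-- The left factor acts first, so that products follow the order in which an automaton reads its
-- input.
Transformations : ℕ → FinSemigroup
Transformations q = record
  { size  = q ^ q
  ; _∙_   = λ u v → funToFin {q} (finToFun v ∘ finToFun u)
  ; assoc = λ u v w → funToFin-cong {q} λ i →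
      trans (cong (finToFun w) (finToFun-funToFin (finToFun v ∘ finToFun u) i))
            (sym (finToFun-funToFin (finToFun w ∘ finToFun v) (finToFun u i)))
  }

-- Idempotent powers

module _ (S : FinSemigroup) where
  open FinSemigroup S

  infixl 8 _^⁺_

  -- A semigroup has no empty product, so exponent `n` stands for the power with `n + 1` factors.
  _^⁺_ : Elem → ℕ → Elem
  s ^⁺ zero  = s
  s ^⁺ suc n = s ∙ s ^⁺ n

  ^⁺-Prod : ∀ s i n → Prod S (const s) i (suc (n + i)) (s ^⁺ n)
  ^⁺-Prod s i zero    = [ i ]
  ^⁺-Prod s i (suc n) = i ∷ subst (λ m → Prod S (const s) (suc i) (suc m) (s ^⁺ n))
                              (ℕₚ.+-suc n i) (^⁺-Prod s (suc i) n)

  ^⁺-+ : ∀ s m n → s ^⁺ m ∙ s ^⁺ n ≡ s ^⁺ suc (m + n)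
  ^⁺-+ s zero    n = refl
  ^⁺-+ s (suc m) n = trans (assoc s _ _) (cong (s ∙_) (^⁺-+ s m n))

  ^⁺-cong-+ : ∀ s {m n} d → s ^⁺ m ≡ s ^⁺ n → s ^⁺ (d + m) ≡ s ^⁺ (d + n)
  ^⁺-cong-+ s zero    eq = eq
  ^⁺-cong-+ s (suc d) eq = cong (s ∙_) (^⁺-cong-+ s d eq)

  -- Induction on the number `k` of periods. The offset `d` is arbitrary because each step moves one
  -- period into it.
  ^⁺-periodic : ∀ s {i p} → s ^⁺ i ≡ s ^⁺ (p + i) → ∀ k d → s ^⁺ (d + i) ≡ s ^⁺ (d + (k * p + i))
  ^⁺-periodic s         eq zero    d = refl
  ^⁺-periodic s {i} {p} eq (suc k) d = begin
    s ^⁺ (d + i)                 ≡⟨ ^⁺-cong-+ s d eq ⟩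
    s ^⁺ (d + (p + i))           ≡⟨ cong (s ^⁺_) (sym (ℕₚ.+-assoc d p i)) ⟩
    s ^⁺ ((d + p) + i)           ≡⟨ ^⁺-periodic s eq k (d + p) ⟩
    s ^⁺ ((d + p) + (k * p + i)) ≡⟨ cong (s ^⁺_) (ℕₚ.+-assoc d p _) ⟩
    s ^⁺ (d + (p + (k * p + i))) ≡⟨ cong (λ n → s ^⁺ (d + n)) (sym (ℕₚ.+-assoc p (k * p) i)) ⟩
    s ^⁺ (d + (suc k * p + i))   ∎
    where open ≡-Reasoning

  -- n + 1  is the multiple  (i + 1) * (p + 1)  of the period  p + 1.
  periodic⇒idempotent : ∀ s i p → s ^⁺ i ≡ s ^⁺ (suc p + i) →
    let n = p + i * p + i in s ^⁺ n ∙ s ^⁺ n ≡ s ^⁺ n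
  periodic⇒idempotent s i p period = begin
    s ^⁺ n ∙ s ^⁺ n                ≡⟨ ^⁺-+ s n n ⟩
    s ^⁺ suc (n + n)               ≡⟨ cong (s ^⁺_) (sym (ℕₚ.+-suc n n)) ⟩
    s ^⁺ (d + i + suc n)           ≡⟨ cong (s ^⁺_) (ℕₚ.+-assoc d i (suc n)) ⟩
    s ^⁺ (d + (i + suc n))         ≡⟨ cong (λ x → s ^⁺ (d + x)) i+1+n≡ ⟩
    s ^⁺ (d + (suc i * suc p + i)) ≡⟨ sym (^⁺-periodic s period (suc i) d) ⟩
    s ^⁺ n                         ∎
    where
    open ≡-Reasoning
    d = p + i * p
    n = d + i
    1+n≡ : suc n ≡ suc i * suc p
    1+n≡ = begin
      suc (p + i * p + i)   ≡⟨ cong suc (ℕₚ.+-assoc p (i * p) i) ⟩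
      suc (p + (i * p + i)) ≡⟨ cong (λ x → suc (p + x)) (ℕₚ.+-comm (i * p) i) ⟩
      suc (p + (i + i * p)) ≡⟨ cong (λ x → suc (p + x)) (sym (ℕₚ.*-suc i p)) ⟩
      suc i * suc p         ∎
    i+1+n≡ : i + suc n ≡ suc i * suc p + i
    i+1+n≡ = trans (ℕₚ.+-comm i (suc n)) (cong (_+ i) 1+n≡)

  idempotent-power : ∀ s → ∃[ n ] s ^⁺ n ∙ s ^⁺ n ≡ s ^⁺ n
  idempotent-power s
    with i , j , i<j , eq ← pigeonhole (n<1+n size) (λ (i : Fin (suc size)) → s ^⁺ toℕ i)
    -- Two of the first `size + 1` powers coincide; `p` is chosen so that `suc p` is the distance
    -- between their exponents.
    = let p = toℕ j ∸ suc (toℕ i) in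
      p + toℕ i * p + toℕ i , periodic⇒idempotent s (toℕ i) p
        (trans eq (cong (s ^⁺_) (sym (trans (sym (ℕₚ.+-suc _ _)) (ℕₚ.m∸n+n≡m i<j)))))

  idempotent : Elem → Elem
  idempotent s = s ^⁺ proj₁ (idempotent-power s)

  -- Cutting the constant sequence into blocks of `n + 1` letters gives every block, the head
  -- included, the same idempotent value.
  const-Factorisation : ∀ s → Factorisation S (const s) (idempotent s) (idempotent s)
  const-Factorisation s = record
    { cut    = cut
    ; head   = subst (λ m → Prod S (const s) 0 (suc m) (s ^⁺ n)) (ℕₚ.+-identityʳ n) (^⁺-Prod s 0 n)
    ; tail   = λ i → ^⁺-Prod s (cut i) n
    ; idem   = proj₂ (idempotent-power s)
    ; absorb = proj₂ (idempotent-power s)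
    }
    where
    n = proj₁ (idempotent-power s)
    cut : ℕ → ℕ
    cut zero    = suc n
    cut (suc i) = suc (n + cut i)

-- Letter formulas

-- One letter of a track: a mark, and possibly an element of A.
Cell : ∀ {ℓ} → Set ℓ → Set ℓ
Cell A = Bool × Maybe A

module _ (σ : Signature) where

  infix  6 _≈_
  infixr 5 _∧_
  infixr 4 _∨_

  -- `i ≈ j` holds only if both cells contain an element, so `i ≈ i` says that cell `i` is filled.
  -- The quantifier ranges over whole cells.
  data LetterFormula (t : ℕ) : Set where
    mark    : Fin t → LetterFormula t
    _≈_     : Fin t → Fin t → LetterFormula t
    rel     : (s : Symbol σ) → Vec (Fin t) (arity σ s) → LetterFormula t
    false   : LetterFormula t
    not     : LetterFormula t → LetterFormula t
    _∧_ _∨_ : LetterFormula t → LetterFormula t → LetterFormula t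
    ex      : LetterFormula (suc t) → LetterFormula t

module _ {a} {A : Set a} where

  allJust : ∀ {n} → Vec (Maybe A) n → Maybe (Vec A n)
  allJust []              = just []
  allJust (nothing ∷ xs)  = nothing
  allJust (just x  ∷ xs)  = Maybe.map (x ∷_) (allJust xs)

  data AllJustView {n} : Vec (Maybe A) n → Maybe (Vec A n) → Set a where
    all-just     : ∀ as → AllJustView (map just as) (just as)
    some-nothing : ∀ {xs} → (∀ as → xs ≢ map just as) → AllJustView xs nothing

  allJustView : ∀ {n} (xs : Vec (Maybe A) n) → AllJustView xs (allJust xs)
  allJustView []             = all-just []
  allJustView (nothing ∷ xs) = some-nothing λ { (_ ∷ _) () }
  allJustView (just x ∷ xs) with allJust xs | allJustView xs
  ... | .(just as) | all-just as     = all-just (x ∷ as)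
  ... | .nothing   | some-nothing ¬j =
    some-nothing λ { (_ ∷ as) eq → ¬j as (proj₂ (∷-injective eq)) }

  map-just⁻ : ∀ {b} {B : Set b} (f : A → B) {n} (xs : Vec (Maybe A) n) {bs} →
              map (Maybe.map f) xs ≡ map just bs → ∃[ as ] xs ≡ map just as
  map-just⁻ f []            {[]}     eq = [] , refl
  map-just⁻ f (just x ∷ xs) {b ∷ bs} eq
    with as , eq′ ← map-just⁻ f xs (proj₂ (∷-injective eq)) = x ∷ as , cong (just x ∷_) eq′

map-just-injective : ∀ {a} {A : Set a} {n} {xs ys : Vec A n} → map just xs ≡ map just ys → xs ≡ ys
map-just-injective {xs = []}     {[]}     eq = refl
map-just-injective {xs = x ∷ xs} {y ∷ ys} eq with p , q ← ∷-injective eq =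
  cong₂ _∷_ (just-injective p) (map-just-injective q)

shift : ∀ {k} → Cell (Fin k) → Cell (Fin (suc k))
shift = Product.map₂ (Maybe.map suc)

module _ {σ : Signature} where

  ⋁ ⋀ : ∀ {t N} → (Fin N → LetterFormula σ t) → LetterFormula σ t
  ⋁ {N = zero}  D = false
  ⋁ {N = suc N} D = D zero ∨ ⋁ (D ∘ suc)
  ⋀ {N = zero}  D = not false
  ⋀ {N = suc N} D = D zero ∧ ⋀ (D ∘ suc)

  when : ∀ {t p} {P : Set p} → Dec P → LetterFormula σ t → LetterFormula σ t
  when P? D = if does P? then D else false

  sameFO : ∀ {k} → Maybe (Fin k) → Maybe (Fin k) → FO σ k
  sameFO (just i) (just j) = i ≐ j
  sameFO _        _        = false

  relFO : ∀ {k} s → Maybe (Vec (Fin k) (arity σ s)) → FO σ k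
  relFO s (just is) = atom s is
  relFO s nothing   = false

  -- `γ` is a symbolic letter: its marks, and which of its cells are filled, are known during
  -- translation, while the elements are first-order variables.
  toFO : ∀ {t k} → Vec (Cell (Fin k)) t → LetterFormula σ t → FO σ k
  toFO γ (mark i)   = if proj₁ (lookup γ i) then not false else false
  toFO γ (i ≈ j)    = sameFO (proj₂ (lookup γ i)) (proj₂ (lookup γ j))
  toFO γ (rel s is) = relFO s (allJust (map (proj₂ ∘ lookup γ) is))
  toFO γ false      = false
  toFO γ (not D)    = not (toFO γ D)
  toFO γ (D ∧ E)    = toFO γ D ∧ toFO γ E
  toFO γ (D ∨ E)    = toFO γ D ∨ toFO γ E
  -- A cell has either mark and is either blank or filled; only the two filled cases introduce a
  -- first-order quantifier.
  toFO γ (ex D)     =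
    (toFO ((true , nothing) ∷ γ) D ∨ toFO ((false , nothing) ∷ γ) D) ∨
    (ex (toFO ((true  , just zero) ∷ map shift γ) D) ∨
     ex (toFO ((false , just zero) ∷ map shift γ) D))

-- Semantics of letter formulas and correctness of their first-order translation.

module _ {σ : Signature} {ℓ : Level} (𝔐 : Structure σ ℓ) where
  open Structure 𝔐 renaming (rel to ⟦_⟧)

  SatL : ∀ {t} → Vec (Cell Carrier) t → LetterFormula σ t → Set ℓ
  SatL v (mark i)   = Lift ℓ (proj₁ (lookup v i) ≡ true)
  SatL v (i ≈ j)    = ∃[ a ] proj₂ (lookup v i) ≡ just a × proj₂ (lookup v j) ≡ just a
  SatL v (rel s is) = ∃[ as ] map (proj₂ ∘ lookup v) is ≡ map just as × ⟦ s ⟧ as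
  SatL v false      = ⊥
  SatL v (not D)    = ¬ SatL v D
  SatL v (D ∧ E)    = SatL v D × SatL v E
  SatL v (D ∨ E)    = SatL v D ⊎ SatL v E
  SatL v (ex D)     = ∃[ x ] SatL (x ∷ v) D

  module _ {t : ℕ} {v : Vec (Cell Carrier) t} where

    SatL-⋁ : ∀ {N} (D : Fin N → LetterFormula σ t) → SatL v (⋁ D) ⇔ (∃[ i ] SatL v (D i))
    SatL-⋁ {zero}  D = mk⇔ (λ ()) (λ ())
    SatL-⋁ {suc N} D = mk⇔
      (λ { (inj₁ d) → zero , d ; (inj₂ d) → Product.map suc id (to (SatL-⋁ (D ∘ suc)) d) })
      (λ { (zero , d) → inj₁ d ; (suc i , d) → inj₂ (from (SatL-⋁ (D ∘ suc)) (i , d)) })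

    SatL-⋀ : ∀ {N} (D : Fin N → LetterFormula σ t) → SatL v (⋀ D) ⇔ (∀ i → SatL v (D i))
    SatL-⋀ {zero}  D = mk⇔ (λ _ ()) (λ _ ())
    SatL-⋀ {suc N} D = mk⇔
      (λ { (d , ds) zero → d ; (d , ds) (suc i) → to (SatL-⋀ (D ∘ suc)) ds i })
      (λ ds → ds zero , from (SatL-⋀ (D ∘ suc)) (ds ∘ suc))

    SatL-when : ∀ {p} {P : Set p} (P? : Dec P) D → SatL v (when P? D) ⇔ (P × SatL v D)
    SatL-when (yes p) D = mk⇔ (p ,_) proj₂
    SatL-when (no ¬p) D = mk⇔ (λ ()) (λ { (p , _) → contradiction p ¬p })

  Instance : ∀ {k} → Vec Carrier k → Cell Carrier → Cell (Fin k) → Set ℓ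
  Instance ρ x c = x ≡ Product.map₂ (Maybe.map (lookup ρ)) c

  Instance-shift : ∀ {k t} {ρ : Vec Carrier k} {a} (v : Vec (Cell Carrier) t) γ →
    (∀ i → Instance ρ (lookup v i) (lookup γ i)) →
    ∀ i → Instance (a ∷ ρ) (lookup v i) (lookup (map shift γ) i)
  Instance-shift {ρ = ρ} {a} v γ inst i =
    trans (inst i) (trans (shifted (lookup γ i)) (cong (Product.map₂ (Maybe.map (lookup (a ∷ ρ))))
      (sym (lookup-map i shift γ))))
    where
    shifted : ∀ c → Product.map₂ (Maybe.map (lookup ρ)) c ≡
              Product.map₂ (Maybe.map (lookup (a ∷ ρ))) (shift c)
    shifted (_ , nothing) = refl
    shifted (_ , just _)  = refl

  SatFO-relFO : ∀ {k} {ρ : Vec Carrier k} s ms {xs} → xs ≡ map (Maybe.map (lookup ρ)) ms →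
    SatFO 𝔐 ρ (relFO s (allJust ms)) ⇔ (∃[ as ] xs ≡ map just as × ⟦ s ⟧ as)
  SatFO-relFO {ρ = ρ} s ms refl with allJust ms | allJustView ms
  ... | _ | all-just js     = mk⇔
    (λ r → _ , ρ-just , r)
    (λ { (as , eq , r) → subst ⟦ s ⟧ (map-just-injective (trans (sym eq) ρ-just)) r })
    where
    ρ-just : map (Maybe.map (lookup ρ)) (map just js) ≡ map just (map (lookup ρ) js)
    ρ-just = trans (sym (map-∘ _ _ js)) (map-∘ _ _ js)
  ... | _ | some-nothing ¬j = mk⇔ (λ ())
    (λ { (as , eq , r) → let js , eq′ = map-just⁻ (lookup ρ) ms eq in contradiction eq′ (¬j js) })

  SatFO-toFO : ∀ {k t} {ρ : Vec Carrier k} {v : Vec (Cell Carrier) t} γ →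
    (∀ i → Instance ρ (lookup v i) (lookup γ i)) →
    ∀ D → SatFO 𝔐 ρ (toFO γ D) ⇔ SatL v D
  SatFO-toFO γ inst (mark i) rewrite inst i with proj₁ (lookup γ i)
  ... | true  = mk⇔ (λ _ → lift refl) (λ _ ())
  ... | false = mk⇔ (λ ()) (λ ())
  SatFO-toFO γ inst (i ≈ j) rewrite inst i | inst j with proj₂ (lookup γ i) | proj₂ (lookup γ j)
  ... | just x  | just y  = mk⇔ (λ eq → _ , refl , cong just (sym eq))
                                (λ { (_ , refl , eq) → sym (just-injective eq) })
  ... | just x  | nothing = mk⇔ (λ ()) (λ { (_ , _ , ()) })
  ... | nothing | _       = mk⇔ (λ ()) (λ { (_ , () , _) })
  SatFO-toFO γ inst (rel s is) = SatFO-relFO s (map (proj₂ ∘ lookup γ) is)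
    (trans (map-cong (cong proj₂ ∘ inst) is) (map-∘ _ _ is))
  SatFO-toFO γ inst false   = mk⇔ id id
  SatFO-toFO γ inst (not D) = let h = SatFO-toFO γ inst D in mk⇔ (_∘ from h) (_∘ to h)
  SatFO-toFO γ inst (D ∧ E) = let h = SatFO-toFO γ inst D ; k = SatFO-toFO γ inst E in
    mk⇔ (Product.map (to h) (to k)) (Product.map (from h) (from k))
  SatFO-toFO γ inst (D ∨ E) = let h = SatFO-toFO γ inst D ; k = SatFO-toFO γ inst E in
    mk⇔ (Sum.map (to h) (to k)) (Sum.map (from h) (from k))
  SatFO-toFO {ρ = ρ} {v} γ inst (ex D) = mk⇔
    (λ { (inj₁ (inj₁ d))       → _ , to (blank true) d
       ; (inj₁ (inj₂ d))       → _ , to (blank false) d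
       ; (inj₂ (inj₁ (a , d))) → _ , to (filled true a) d
       ; (inj₂ (inj₂ (a , d))) → _ , to (filled false a) d })
    (λ { ((true  , nothing) , d) → inj₁ (inj₁ (from (blank true) d))
       ; ((false , nothing) , d) → inj₁ (inj₂ (from (blank false) d))
       ; ((true  , just a)  , d) → inj₂ (inj₁ (a , from (filled true a) d))
       ; ((false , just a)  , d) → inj₂ (inj₂ (a , from (filled false a) d)) })
    where
    blank : ∀ b → SatFO 𝔐 ρ (toFO ((b , nothing) ∷ γ) D) ⇔ SatL ((b , nothing) ∷ v) D
    blank b = SatFO-toFO _ (λ { zero → refl ; (suc i) → inst i }) D
    filled : ∀ b a → SatFO 𝔐 (a ∷ ρ) (toFO ((b , just zero) ∷ map shift γ) D) ⇔
                     SatL ((b , just a) ∷ v) D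
    filled b a = SatFO-toFO _ (λ { zero → refl ; (suc i) → Instance-shift v γ inst i }) D

-- Track formulas and their recognisers

module _ (σ : Signature) where

  data TrackFormula (t : ℕ) : Set where
    everywhere : LetterFormula σ t → TrackFormula t
    word       : Fin t → TrackFormula t
    not        : TrackFormula t → TrackFormula t
    _∧_        : TrackFormula t → TrackFormula t → TrackFormula t
    ex         : TrackFormula (suc t) → TrackFormula t

  record Recogniser (t : ℕ) : Set₁ where
    field
      semigroup : FinSemigroup
    open FinSemigroup semigroup public
    field
      letter  : Elem → LetterFormula σ t
      Accept  : Elem → Elem → Set
      accept? : ∀ s e → Dec (Accept s e)

  record Automaton (t : ℕ) : Set where
    field
      states classes : ℕ
      δ              : Fin classes → Fin states → Fin states
      start final    : Fin states
      class          : Fin classes → LetterFormula σ t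

run : ∀ {m q} → (Fin m → Fin q → Fin q) → Fin q → (ℕ → Fin m) → ℕ → Fin q
run δ q f zero    = q
run δ q f (suc n) = run δ (δ (f 0) q) (f ∘ suc) n

module _ {m q} {δ : Fin m → Fin q → Fin q} where

  run-suc : ∀ s f n → run δ s f (suc n) ≡ δ (f n) (run δ s f n)
  run-suc s f zero    = refl
  run-suc s f (suc n) = run-suc (δ (f 0) s) (f ∘ suc) n

  run-cong : ∀ s {f g} → (∀ n → f n ≡ g n) → ∀ n → run δ s f n ≡ run δ s g n
  run-cong s         f≗g zero    = refl
  run-cong s {f} {g} f≗g (suc n) = trans (run-cong (δ (f 0) s) (f≗g ∘ suc) n)
    (cong (λ c → run δ (δ c s) (g ∘ suc) n) (f≗g 0))

  run-Prod : ∀ s f {i j u} → Prod (Transformations q) (funToFin ∘ δ ∘ f) i j u →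
             run δ s f j ≡ finToFun {q} {q} u (run δ s f i)
  run-Prod s f [ i ] = trans (run-suc s f i) (sym (finToFun-funToFin (δ (f i)) _))
  run-Prod s f (_∷_ i {j} {u} p) = begin
    run δ s f j                                  ≡⟨ run-Prod s f p ⟩
    apply u (run δ s f (suc i))                  ≡⟨ cong (apply u) (run-Prod s f [ i ]) ⟩
    apply u (apply v (run δ s f i))              ≡⟨ sym (finToFun-funToFin uv _) ⟩
    apply (funToFin uv) (run δ s f i)            ∎
    where
    open ≡-Reasoning
    apply = finToFun {q} {q}
    v = funToFin (δ (f i))
    uv : Fin q → Fin q
    uv = apply u ∘ apply v

pattern initial   = zero
pattern inside    = suc zero
pattern completed = suc (suc zero)
pattern dead      = suc (suc (suc zero))

pattern mark-only = zero
pattern blank     = suc zero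
pattern filled    = suc (suc zero)
pattern last-cell = suc (suc (suc zero))

-- The codes of words have two shapes: `mark-only` followed by blanks for the empty word, and
-- otherwise one `blank`, some `filled` cells, one `last-cell` and then blanks. Every deviation
-- leads to the sink `dead`.
word-δ : Fin 4 → Fin 4 → Fin 4
word-δ mark-only initial   = completed
word-δ blank     initial   = inside
word-δ filled    inside    = inside
word-δ last-cell inside    = completed
word-δ blank     completed = completed
word-δ _         _         = dead

module _ {σ : Signature} where

  literal : ∀ {t p} {P : Set p} → Dec P → LetterFormula σ t → LetterFormula σ t
  literal P? D = if does P? then D else not D

  -- As `s` absorbs `e`, the state that `s` reaches from `start` recurs at every cut, and acceptance
  -- asks whether it is `final`.
  fromAutomaton : ∀ {t} → Automaton σ t → Recogniser σ t
  fromAutomaton A = record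
    { semigroup = Transformations states
    ; letter    = λ u → ⋁ λ x → when (funToFin (δ x) ≟ᶠ u) (class x)
    ; Accept    = λ s e → finToFun s start ≡ final
    ; accept?   = λ s e → finToFun s start ≟ᶠ final
    }
    where open Automaton A

  -- State `zero` records that no letter has violated `D` so far; the other state is a sink.
  everywhere-automaton : ∀ {t} → LetterFormula σ t → Automaton σ t
  everywhere-automaton D = record
    { states = 2 ; classes = 2
    ; δ      = λ { zero q → q ; (suc zero) _ → suc zero }
    ; start  = zero ; final = zero
    ; class  = λ { zero → D ; (suc zero) → not D }
    }

  word-automaton : ∀ {t} → Fin t → Automaton σ t
  word-automaton i = record
    { states = 4 ; classes = 4
    ; δ      = word-δ
    ; start  = initial ; final = completed
    ; class  = λ { mark-only → mark i ∧ not (i ≈ i)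
                 ; blank     → not (mark i) ∧ not (i ≈ i)
                 ; filled    → not (mark i) ∧ i ≈ i
                 ; last-cell → mark i ∧ i ≈ i }
    }

  complement : ∀ {t} → Recogniser σ t → Recogniser σ t
  complement R = record
    { semigroup = semigroup
    ; letter    = letter
    ; Accept    = λ s e → ¬ Accept s e
    ; accept?   = λ s e → ¬? (accept? s e)
    }
    where open Recogniser R

  product : ∀ {t} → Recogniser σ t → Recogniser σ t → Recogniser σ t
  product R R′ = record
    { semigroup = R.semigroup ⊗ R′.semigroup
    ; letter    = λ x → R.letter (fst x) ∧ R′.letter (snd x)
    ; Accept    = λ s e → R.Accept (fst s) (fst e) × R′.Accept (snd s) (snd e)
    ; accept?   = λ s e → R.accept? (fst s) (fst e) ×-dec R′.accept? (snd s) (snd e)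
    }
    where
    module R = Recogniser R
    module R′ = Recogniser R′
    fst : Fin (R.size * R′.size) → R.Elem
    fst = proj₁ ∘ remQuot R′.size
    snd : Fin (R.size * R′.size) → R′.Elem
    snd = proj₂ ∘ remQuot {R.size} R′.size

  projection : ∀ {t} → Recogniser σ (suc t) → Recogniser σ t
  projection R = record
    { semigroup = 𝒫 semigroup
    ; letter    = λ U → ⋀ λ s → literal (U ∋? s) (ex (letter s))
    -- A pair of members of linked sets need not itself be linked, so the two equations are demanded
    -- explicitly.
    ; Accept    = λ U V → ∃₂ λ s e → U ∋ s × V ∋ e × s ∙ e ≡ s × e ∙ e ≡ e × Accept s e
    ; accept?   = λ U V → any? λ s → any? λ e →
        (U ∋? s) ×-dec (V ∋? e) ×-dec (s ∙ e ≟ᶠ s) ×-dec (e ∙ e ≟ᶠ e) ×-dec accept? s e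
    }
    where open Recogniser R

  recogniser : ∀ {t} → TrackFormula σ t → Recogniser σ t
  recogniser (everywhere D) = fromAutomaton (everywhere-automaton D)
  recogniser (word i)       = fromAutomaton (word-automaton i)
  recogniser (not φ)        = complement (recogniser φ)
  recogniser (φ ∧ ψ)        = product (recogniser φ) (recogniser ψ)
  recogniser (ex φ)         = projection (recogniser φ)

-- Codes of words

module _ {a} {A : Set a} where

  -- Letters are shifted by one position: the mark of  w , at position  length w ,
  -- then sits on its last letter, and the empty word has a marked position as well.
  codeTail : List A → ℕ → Cell A
  codeTail []      n       = false , nothing
  codeTail (a ∷ w) zero    = null w , just a
  codeTail (a ∷ w) (suc n) = codeTail w n

  code : List A → ℕ → Cell A
  code w zero    = null w , nothing
  code w (suc n) = codeTail w n

  cellClass : Cell A → Fin 4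
  cellClass (true  , nothing) = mark-only
  cellClass (false , nothing) = blank
  cellClass (false , just _)  = filled
  cellClass (true  , just _)  = last-cell

  cellClass-blank : ∀ {x} → cellClass x ≡ blank → x ≡ (false , nothing)
  cellClass-blank {true  , nothing} ()
  cellClass-blank {false , nothing} _ = refl
  cellClass-blank {false , just _}  ()
  cellClass-blank {true  , just _}  ()

  -- Büchi acceptance from state `q`: `completed` recurs forever. The strict inequality guarantees a
  -- first letter to strip off.
  Completing : Fin 4 → (ℕ → Cell A) → Set
  Completing q γ = ∀ n → ∃[ m ] n < m × run word-δ q (cellClass ∘ γ) m ≡ completed

  Completing-suc : ∀ {q γ} → Completing q γ → Completing (word-δ (cellClass (γ 0)) q) (γ ∘ suc)
  Completing-suc c n with suc m , s≤s n<m , eq ← c (suc n) = m , n<m , eq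

  word-δ-dead : ∀ x → word-δ x dead ≡ dead
  word-δ-dead mark-only = refl
  word-δ-dead blank     = refl
  word-δ-dead filled    = refl
  word-δ-dead last-cell = refl

  run-dead : ∀ f n → run word-δ dead f n ≡ dead
  run-dead f zero    = refl
  run-dead f (suc n) rewrite word-δ-dead (f 0) = run-dead (f ∘ suc) n

  ¬Completing-dead : ∀ {γ} → ¬ Completing dead γ
  ¬Completing-dead {γ} c with m , _ , eq ← c 0 with () ← trans (sym (run-dead (cellClass ∘ γ) m)) eq

  -- Any letter other than a blank would lead from `completed` to `dead`, from which `completed` is
  -- unreachable.
  completed⇒blank : ∀ {γ} → Completing completed γ → ∀ n → γ n ≡ (false , nothing)
  completed⇒blank {γ} c n with γ 0 in eq | Completing-suc c
  completed⇒blank c zero    | false , nothing | _  = eq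
  completed⇒blank c (suc n) | false , nothing | c′ = completed⇒blank c′ n
  ... | true  , nothing | c′ = contradiction c′ ¬Completing-dead
  ... | false , just _  | c′ = contradiction c′ ¬Completing-dead
  ... | true  , just _  | c′ = contradiction c′ ¬Completing-dead

  -- The time `m` at which `completed` is reached bounds the length of the word and drives the
  -- recursion. Nonemptiness is carried along because it makes the mark of the preceding cell
  -- `false`.
  inside⇒word : ∀ m {γ} → run word-δ inside (cellClass ∘ γ) m ≡ completed → Completing inside γ →
    ∃[ w ] null w ≡ false × (∀ n → γ n ≡ codeTail w n)
  inside⇒word (suc m) {γ} r c with γ 0 in eq | Completing-suc c
  ... | true  , nothing | c′ = contradiction c′ ¬Completing-dead
  ... | false , nothing | c′ = contradiction c′ ¬Completing-dead
  ... | false , just a  | c′ with w , ¬null , h ← inside⇒word m r c′ =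
    a ∷ w , refl , λ { zero → trans eq (cong (_, just a) (sym ¬null)) ; (suc n) → h n }
  ... | true  , just a  | c′ =
    a ∷ [] , refl , λ { zero → eq ; (suc n) → completed⇒blank c′ n }

  initial⇒word : ∀ {γ} → Completing initial γ → ∃[ w ] (∀ n → γ n ≡ code w n)
  initial⇒word {γ} c with γ 0 in eq | Completing-suc c
  ... | true  , nothing | c′ = [] , λ { zero → eq ; (suc n) → completed⇒blank c′ n }
  ... | false , just _  | c′ = contradiction c′ ¬Completing-dead
  ... | true  , just _  | c′ = contradiction c′ ¬Completing-dead
  ... | false , nothing | c′
    with m , _ , r ← c′ 0
    with w , ¬null , h ← inside⇒word m r c′
    = w , λ { zero → trans eq (cong (_, nothing) (sym ¬null)) ; (suc n) → h n }

  run-blanks : ∀ n → run word-δ completed (cellClass ∘ codeTail []) n ≡ completed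
  run-blanks zero    = refl
  run-blanks (suc n) = run-blanks n

  run-codeTail : ∀ a w {n} → length (a ∷ w) ≤ n →
                 run word-δ inside (cellClass ∘ codeTail (a ∷ w)) n ≡ completed
  run-codeTail a []      {suc n} _         = run-blanks n
  run-codeTail a (b ∷ w) {suc n} (s≤s w≤n) = run-codeTail b w w≤n

  run-code : ∀ w {n} → length w < n → run word-δ initial (cellClass ∘ code w) n ≡ completed
  run-code []      {suc n} _         = run-blanks n
  run-code (a ∷ w) {suc n} (s≤s w≤n) = run-codeTail a w w≤n

-- Semantics of track formulas, and recognition for automata and Boolean operations.

module _ {σ : Signature} {ℓ : Level} (𝔐 : Structure σ ℓ) where
  open Structure 𝔐 using (Carrier)

  Tracks : ℕ → Set ℓ
  Tracks t = ℕ → Vec (Cell Carrier) t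

  infixr 5 _∷ᵗ_

  _∷ᵗ_ : ∀ {t} → (ℕ → Cell Carrier) → Tracks t → Tracks (suc t)
  (γ ∷ᵗ α) n = γ n ∷ α n

  SatT : ∀ {t} → Tracks t → TrackFormula σ t → Set ℓ
  SatT α (everywhere D) = ∀ n → SatL 𝔐 (α n) D
  SatT α (word i)       = ∃[ w ] ∀ n → lookup (α n) i ≡ code w n
  SatT α (not φ)        = ¬ SatT α φ
  SatT α (φ ∧ ψ)        = SatT α φ × SatT α ψ
  SatT α (ex φ)         = ∃[ γ ] SatT (γ ∷ᵗ α) φ

  -- By Ramsey every sequence has a factorisation, so such a recogniser
  -- determines the language.
  record Recognises {t} (R : Recogniser σ t) (L : Tracks t → Set ℓ) : Set ℓ where
    open Recogniser R
    field
      value        : Vec (Cell Carrier) t → Elem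
      letter-value : ∀ v s → SatL 𝔐 v (letter s) ⇔ value v ≡ s
      correct      : ∀ α {s e} → Factorisation semigroup (value ∘ α) s e → L α ⇔ Accept s e

  SatL-literal : ∀ {t p} {P : Set p} (P? : Dec P) {v : Vec (Cell Carrier) t} {D} →
                 SatL 𝔐 v (literal P? D) ⇔ (P ⇔ SatL 𝔐 v D)
  SatL-literal (yes p) = mk⇔ (λ d → mk⇔ (λ _ → d) (λ _ → p)) (λ h → to h p)
  SatL-literal (no ¬p) = mk⇔ (λ ¬d → mk⇔ (λ p → contradiction p ¬p) (λ d → contradiction d ¬d))
                             (λ h d → ¬p (from h d))

  module _ {t} (A : Automaton σ t) where
    open Automaton A

    module _
      (classOf : Vec (Cell Carrier) t → Fin classes)
      (class-classOf : ∀ v x → SatL 𝔐 v (class x) ⇔ classOf v ≡ x)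
      {L : Tracks t → Set ℓ}
      (limit : ∀ (α : Tracks t) (cut : ℕ → ℕ) (q : Fin states) → (∀ n → n < cut n) →
               (∀ i → run δ start (classOf ∘ α) (cut i) ≡ q) → L α ⇔ q ≡ final)
      where

      -- By `prefix-value` the run is in one and the same state at all cuts of a factorisation, and
      -- the cuts grow beyond every position; this is the situation that `limit` describes.
      fromAutomaton-recognises : Recognises (fromAutomaton A) L
      fromAutomaton-recognises = record
        { value        = funToFin ∘ δ ∘ classOf
        ; letter-value = λ v u → mk⇔
            (λ d → let x , d′ = to (SatL-⋁ 𝔐 _) d
                       δx≡u , d″ = to (SatL-when 𝔐 (funToFin (δ x) ≟ᶠ u) (class x)) d′ in
                   trans (cong (funToFin ∘ δ) (to (class-classOf v x) d″)) δx≡u)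
            (λ eq → from (SatL-⋁ 𝔐 _)
              (classOf v , from (SatL-when 𝔐 (_ ≟ᶠ u) (class _)) (eq , from (class-classOf v _) refl)))
        ; correct      = λ α F → let open Factorisation F in
            limit α cut _ (id<c (λ i → Prod-< (tail i)) (Prod-< head))
              (λ i → run-Prod start (classOf ∘ α) (prefix-value F i))
        }

  module _ {t} {R : Recogniser σ t} {L : Tracks t → Set ℓ} (rec : Recognises R L) where
    open Recognises rec

    complement-recognises : Recognises (complement R) (λ α → ¬ L α)
    complement-recognises = record
      { value        = value
      ; letter-value = letter-value
      ; correct      = λ α F → let h = correct α F in mk⇔ (_∘ from h) (_∘ to h)
      }

  module _ {t} {R R′ : Recogniser σ t} {L L′ : Tracks t → Set ℓ}
           (rec : Recognises R L) (rec′ : Recognises R′ L′) where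
    private
      module R = Recogniser R
      module R′ = Recogniser R′
      module V = Recognises rec
      module V′ = Recognises rec′
      fst : Fin (R.size * R′.size) → R.Elem
      fst = proj₁ ∘ remQuot R′.size
      snd : Fin (R.size * R′.size) → R′.Elem
      snd = proj₂ ∘ remQuot {R.size} R′.size
      fst-combine : ∀ x y → fst (combine x y) ≡ x
      fst-combine x y = cong proj₁ (remQuot-combine x y)
      snd-combine : ∀ x y → snd (combine x y) ≡ y
      snd-combine x y = cong proj₂ (remQuot-combine {R.size} x y)

    -- Both projections are homomorphisms, so a factorisation in the product yields one in each
    -- component with the same cuts.
    product-recognises : Recognises (product R R′) (λ α → L α × L′ α)
    product-recognises = record
      { value        = λ v → combine (V.value v) (V′.value v)
      ; letter-value = λ v s → mk⇔
          (λ { (d , d′) → trans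
                 (cong₂ combine (to (V.letter-value v (fst s)) d) (to (V′.letter-value v (snd s)) d′))
                 (combine-remQuot {R.size} R′.size s) })
          (λ { refl → from (V.letter-value v _) (sym (fst-combine _ _))
                    , from (V′.letter-value v _) (sym (snd-combine (V.value v) _)) })
      ; correct      = λ α F →
          let h = V.correct α (Factorisation-cong (λ n → fst-combine _ _)
                    (Factorisation-map fst (λ x y → fst-combine _ _) F))
              k = V′.correct α (Factorisation-cong (λ n → snd-combine (V.value (α n)) _)
                    (Factorisation-map snd (λ x y → snd-combine (fst x R.∙ fst y) _) F))
          in mk⇔ (Product.map (to h) (to k)) (Product.map (from h) (from k))
      }

  module _ (em : ExcludedMiddle ℓ) where

    lower-em : ExcludedMiddle Level.zero
    lower-em = map′ lower lift (em {Lift ℓ _})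

    everywhere-recognises : ∀ {t} (D : LetterFormula σ t) →
      Recognises (fromAutomaton (everywhere-automaton D)) (λ α → ∀ n → SatL 𝔐 (α n) D)
    everywhere-recognises {t} D =
      fromAutomaton-recognises (everywhere-automaton D) classOf class-classOf limit
      where
      open Automaton (everywhere-automaton D)

      classOf : Vec (Cell Carrier) t → Fin 2
      classOf v with em {SatL 𝔐 v D}
      ... | yes _ = zero
      ... | no  _ = suc zero

      class-classOf : ∀ v x → SatL 𝔐 v (class x) ⇔ classOf v ≡ x
      class-classOf v zero with em {SatL 𝔐 v D}
      ... | yes d = mk⇔ (λ _ → refl) (λ _ → d)
      ... | no ¬d = mk⇔ (λ d → contradiction d ¬d) (λ ())
      class-classOf v (suc zero) with em {SatL 𝔐 v D}
      ... | yes d = mk⇔ (λ ¬d → contradiction d ¬d) (λ ())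
      ... | no ¬d = mk⇔ (λ _ → refl) (λ _ → ¬d)

      run-1 : ∀ f n → run δ (suc zero) f n ≡ suc zero
      run-1 f zero    = refl
      run-1 f (suc n) with f 0
      ... | zero     = run-1 (f ∘ suc) n
      ... | suc zero = run-1 (f ∘ suc) n

      run-0⁺ : ∀ f → (∀ n → f n ≡ zero) → ∀ n → run δ zero f n ≡ zero
      run-0⁺ f f≡0 zero    = refl
      run-0⁺ f f≡0 (suc n) rewrite f≡0 0 = run-0⁺ (f ∘ suc) (f≡0 ∘ suc) n

      run-0⁻ : ∀ f m → run δ zero f m ≡ zero → ∀ {n} → n < m → f n ≡ zero
      run-0⁻ f (suc m) r n<m with f 0 in eq
      run-0⁻ f (suc m) r {zero}  n<m       | zero     = eq
      run-0⁻ f (suc m) r {suc n} (s≤s n<m) | zero     = run-0⁻ (f ∘ suc) m r n<m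
      ...                                  | suc zero with () ← trans (sym (run-1 (f ∘ suc) m)) r

      limit : ∀ α cut q → (∀ n → n < cut n) →
              (∀ i → run δ start (classOf ∘ α) (cut i) ≡ q) → (∀ n → SatL 𝔐 (α n) D) ⇔ q ≡ final
      limit α cut q n<cut r = mk⇔
        (λ d → trans (sym (r 0)) (run-0⁺ _ (λ n → to (class-classOf (α n) zero) (d n)) (cut 0)))
        -- Since `cut n` lies beyond `n`, state `zero` at that cut certifies letter `n`.
        (λ { refl n → from (class-classOf (α n) zero) (run-0⁻ _ (cut n) (r n) (n<cut n)) })

  word-recognises : ∀ {t} (i : Fin t) →
    Recognises (fromAutomaton (word-automaton i)) (λ α → ∃[ w ] ∀ n → lookup (α n) i ≡ code w n)
  word-recognises {t} i =
    fromAutomaton-recognises (word-automaton i) classOf class-classOf limit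
    where
    open Automaton {σ = σ} (word-automaton i)

    classOf : Vec (Cell Carrier) t → Fin 4
    classOf v = cellClass (lookup v i)

    class-classOf : ∀ v x → SatL 𝔐 v (class x) ⇔ classOf v ≡ x
    class-classOf v mark-only with lookup v i
    ... | true  , nothing = mk⇔ (λ _ → refl) (λ _ → lift refl , λ { (_ , () , _) })
    ... | false , nothing = mk⇔ (λ { (lift () , _) }) (λ ())
    ... | false , just _  = mk⇔ (λ { (lift () , _) }) (λ ())
    ... | true  , just _  = mk⇔ (λ { (_ , ¬j) → contradiction (_ , refl , refl) ¬j }) (λ ())
    class-classOf v blank with lookup v i
    ... | true  , nothing = mk⇔ (λ { (¬m , _) → contradiction (lift refl) ¬m }) (λ ())
    ... | false , nothing = mk⇔ (λ _ → refl) (λ _ → (λ { (lift ()) }) , λ { (_ , () , _) })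
    ... | false , just _  = mk⇔ (λ { (_ , ¬j) → contradiction (_ , refl , refl) ¬j }) (λ ())
    ... | true  , just _  = mk⇔ (λ { (¬m , _) → contradiction (lift refl) ¬m }) (λ ())
    class-classOf v filled with lookup v i
    ... | true  , nothing = mk⇔ (λ { (_ , _ , () , _) }) (λ ())
    ... | false , nothing = mk⇔ (λ { (_ , _ , () , _) }) (λ ())
    ... | false , just _  = mk⇔ (λ _ → refl) (λ _ → (λ { (lift ()) }) , _ , refl , refl)
    ... | true  , just _  = mk⇔ (λ { (¬m , _) → contradiction (lift refl) ¬m }) (λ ())
    class-classOf v last-cell with lookup v i
    ... | true  , nothing = mk⇔ (λ { (_ , _ , () , _) }) (λ ())
    ... | false , nothing = mk⇔ (λ { (_ , _ , () , _) }) (λ ())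
    ... | false , just _  = mk⇔ (λ { (lift () , _) }) (λ ())
    ... | true  , just _  = mk⇔ (λ _ → refl) (λ _ → lift refl , _ , refl , refl)

    limit : ∀ α cut q → (∀ n → n < cut n) → (∀ i → run δ start (classOf ∘ α) (cut i) ≡ q) →
            (∃[ w ] ∀ n → lookup (α n) i ≡ code w n) ⇔ q ≡ final
    limit α cut q n<cut r = mk⇔
      -- The cut with index `length w` lies beyond `length w`, so the run has completed `w` there.
      (λ { (w , h) → trans (sym (r (length w)))
             (trans (run-cong initial (cong cellClass ∘ h) (cut (length w)))
                    (run-code w (n<cut _))) })
      (λ { refl → initial⇒word (λ n → cut n , n<cut n , r n) })

-- Projection: lifting factorisations through the powerset semigroup.

module _ {σ : Signature} {ℓ : Level} (𝔐 : Structure σ ℓ) (em : ExcludedMiddle ℓ) where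
  open Structure 𝔐 using (Carrier)

  module _ {t} {R : Recogniser σ (suc t)} {L : Tracks 𝔐 (suc t) → Set ℓ}
           (rec : Recognises 𝔐 R L) where
    open Recogniser R
    open Recognises rec
    open Powerset semigroup

    image? : ∀ v (s : Elem) → Dec (∃[ x ] value (x ∷ v) ≡ s)
    image? v s = em

    values : Vec (Cell Carrier) t → Fin (2 ^ size)
    values v = ⟪ image? v ⟫

    ∋-values : ∀ v s → values v ∋ s ⇔ (∃[ x ] value (x ∷ v) ≡ s)
    ∋-values v s = ∋-⟪⟫ (image? v) s

    letter-values : ∀ v U → SatL 𝔐 v (⋀ λ s → literal (U ∋? s) (ex (letter s))) ⇔ values v ≡ U
    letter-values v U = mk⇔
      (λ d → ∋-ext λ s → let h = to (SatL-literal 𝔐 (U ∋? s)) (to (SatL-⋀ 𝔐 _) d s) in mk⇔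
        (λ s∈ → from h (to (ex-letter s) s∈))
        (λ s∈ → from (ex-letter s) (to h s∈)))
      (λ { refl → from (SatL-⋀ 𝔐 _) λ s → from (SatL-literal 𝔐 (U ∋? s)) (ex-letter s) })
      where
      ex-letter : ∀ s → values v ∋ s ⇔ SatL 𝔐 v (ex (letter s))
      ex-letter s = mk⇔
        (λ s∈ → Product.map₂ (from (letter-value _ s)) (to (∋-values v s) s∈))
        (λ d → from (∋-values v s) (Product.map₂ (to (letter-value _ s)) d))

    module _ (α : Tracks 𝔐 t) where
      lifted : (ℕ → Cell Carrier) → ℕ → Elem
      lifted γ n = value (γ n ∷ α n)

      -- Together with `choose` this identifies the powerset value of an interval with the set of
      -- values of its lifts.
      project : ∀ γ {i j s U} → Prod semigroup (lifted γ) i j s →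
                Prod (𝒫 semigroup) (values ∘ α) i j U → U ∋ s
      project γ [ i ]   [ .i ]   = from (∋-values (α i) _) (γ i , refl)
      project γ [ i ]   (.i ∷ q) = contradiction (Prod-< q) (<-irrefl refl)
      project γ (i ∷ p) [ .i ]   = contradiction (Prod-< p) (<-irrefl refl)
      project γ (i ∷ p) (_∷_ .i {s = V} q) =
        ∙-∋-⊙ (values (α i)) V (from (∋-values (α i) _) (γ i , refl)) (project γ p q)

      choose : ∀ {i j s U} → Prod (𝒫 semigroup) (values ∘ α) i j U → U ∋ s →
               ∃[ γ ] Prod semigroup (lifted γ) i j s
      choose {s = s} [ i ] s∈ with x , refl ← to (∋-values (α i) s) s∈ = const x , [ i ]
      choose {s = s} (_∷_ i {s = V} p) s∈
        with u , v , u∈ , v∈ , refl ← to (∋-⊙ (values (α i)) V s) s∈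
        with x , refl ← to (∋-values (α i) u) u∈
        with γ , q ← choose p v∈
        = γ′ , subst (λ y → Prod semigroup (lifted γ′) i _ (y ∙ v)) here
                 (i ∷ Prod-cong there q)
        where
        -- The lift of the remaining interval, overridden at the first position `i`.
        γ′ : ℕ → Cell Carrier
        γ′ n with n ≟ i
        ... | yes _ = x
        ... | no  _ = γ n
        here : lifted γ′ i ≡ value (x ∷ α i)
        here with i ≟ i
        ... | yes _   = refl
        ... | no  i≢i = contradiction refl i≢i
        there : ∀ n → suc i ≤ n → n < _ → lifted γ n ≡ lifted γ′ n
        there n i<n _ with n ≟ i
        ... | yes refl = contradiction i<n (<-irrefl refl)
        ... | no  _    = refl

      module _ {U V} (F : Factorisation (𝒫 semigroup) (values ∘ α) U V) where
        open Factorisation F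

        cut↑ : StrictlyIncreasing cut
        cut↑ i = Prod-< (tail i)

        -- Regroups the factors so that they also have a common value upstairs.
        regroup : ∀ γ → ∃₂ λ s e → U ∋ s × V ∋ e × Factorisation semigroup (lifted γ) s e
        regroup γ
          -- The pairs of cuts are coloured by the value of the lifted product between them.
          with g , e , g↑ , homogeneous ← ramsey (lower-em 𝔐 em)
                 (λ i j → Prod semigroup (lifted γ) (cut i) (cut j))
                 (λ i<j → Prod-total (lifted γ) (mono-< cut↑ i<j))
          with s , p ← Prod-total (lifted γ) (<-≤-trans (Prod-< head) (mono-≤ cut↑ {0} {g 0} z≤n))
          -- The head extends to the second homogeneous cut `g 1`, so that its value ends in `e` and
          -- therefore absorbs `e`.
          = s ∙ e , e
          , project γ head′ (prefix-value F (g 1))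
          , project γ (homogeneous (n<1+n 0)) (factor-value F (g↑ 0))
          , record
            { cut    = cut ∘ g ∘ suc
            ; head   = head′
            ; tail   = λ i → homogeneous (n<1+n (suc i))
            ; idem   = idem′
            ; absorb = trans (assoc s e e) (cong (s ∙_) idem′)
            }
          where
          -- Three homogeneous cuts: both short intervals and their union have value `e`.
          idem′ : e ∙ e ≡ e
          idem′ = Prod-unique (Prod-++ (homogeneous (n<1+n 0)) (homogeneous (n<1+n 1)))
                              (homogeneous z<s)
          head′ : Prod semigroup (lifted γ) 0 (cut (g 1)) (s ∙ e)
          head′ = Prod-++ p (homogeneous (n<1+n 0))

        -- Glues lifts chosen independently on the factors.
        glue : ∀ {s e} → U ∋ s → V ∋ e → s ∙ e ≡ s → e ∙ e ≡ e →
               ∃[ γ ] Factorisation semigroup (lifted γ) s e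
        glue {s} {e} s∈ e∈ absorb′ idem′ = γ , record
          { cut    = cut
          ; head   = Prod-cong (λ n _ n<c → on-block n (block-zero cut↑ 0<cut n<c))
                       (proj₂ (choose head s∈))
          ; tail   = λ i → Prod-cong (λ n c≤n n<c → on-block n (block-suc cut↑ 0<cut c≤n n<c))
                       (proj₂ (choose (tail i) e∈))
          ; idem   = idem′
          ; absorb = absorb′
          }
          where
          0<cut : 0 < cut 0
          0<cut = Prod-< head
          choice : ℕ → ℕ → Cell Carrier
          choice zero    = proj₁ (choose head s∈)
          choice (suc i) = proj₁ (choose (tail i) e∈)
          γ : ℕ → Cell Carrier
          γ n = choice (proj₁ (block cut↑ 0<cut n)) n
          on-block : ∀ n {b} → proj₁ (block cut↑ 0<cut n) ≡ b → lifted (choice b) n ≡ lifted γ n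
          on-block n eq = cong (λ b → lifted (choice b) n) (sym eq)

    projection-recognises : Recognises 𝔐 (projection R) (λ α → ∃[ γ ] L (_∷ᵗ_ 𝔐 γ α))
    projection-recognises = record
      { value        = values
      ; letter-value = letter-values
      ; correct      = λ α F → mk⇔
          (λ { (γ , l) → let s , e , s∈ , e∈ , F′ = regroup α F γ in
                 s , e , s∈ , e∈ , Factorisation.absorb F′ , Factorisation.idem F′ ,
                 to (correct (_∷ᵗ_ 𝔐 γ α) F′) l })
          (λ { (s , e , s∈ , e∈ , absorb , idem , acc) →
                 let γ , F′ = glue α F s∈ e∈ absorb idem in
                 γ , from (correct (_∷ᵗ_ 𝔐 γ α) F′) acc })
      }

  recogniser-recognises : ∀ {t} (φ : TrackFormula σ t) →
                          Recognises 𝔐 (recogniser φ) (λ α → SatT 𝔐 α φ)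
  recogniser-recognises (everywhere D) = everywhere-recognises 𝔐 em D
  recogniser-recognises (word i)       = word-recognises 𝔐 i
  recogniser-recognises (not φ)        = complement-recognises 𝔐 (recogniser-recognises φ)
  recogniser-recognises (φ ∧ ψ)        =
    product-recognises 𝔐 (recogniser-recognises φ) (recogniser-recognises ψ)
  recogniser-recognises (ex φ)         = projection-recognises (recogniser-recognises φ)

-- Without tracks there is a single ω-word, and its factorisations are given by
-- the idempotent powers of the value of its letter.
module _ {σ : Signature} (φ : TrackFormula σ 0) where
  open Recogniser (recogniser φ)

  acceptedValue : LetterFormula σ 0
  acceptedValue =
    ⋁ λ s → when (accept? (idempotent semigroup s) (idempotent semigroup s)) (letter s)

  sentence : FOSentence σ
  sentence = toFO [] acceptedValue

  sentence-correct : ∀ {ℓ} (𝔐 : Structure σ ℓ) → ExcludedMiddle ℓ →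
                     SatT 𝔐 (const []) φ ⇔ SatFO 𝔐 [] sentence
  sentence-correct 𝔐 em = ⇔-sym (SatFO-toFO 𝔐 [] (λ ()) acceptedValue) ⇔-∘ mk⇔
    (λ sat → from (SatL-⋁ 𝔐 _)
      (s , from (SatL-when 𝔐 (accept? (idempotent semigroup s) _) (letter s))
             (to (correct (const []) F) sat , from (letter-value [] s) refl)))
    (λ sat → let s′ , d = to (SatL-⋁ 𝔐 _) sat
                 acc , d′ = to (SatL-when 𝔐 (accept? (idempotent semigroup s′) _) (letter s′)) d in
      from (correct (const []) F)
        (subst (λ s → Accept (idempotent semigroup s) (idempotent semigroup s))
          (sym (to (letter-value [] s′) d′)) acc))
    where
    open Recognises (recogniser-recognises 𝔐 em φ)
    s = value []
    F = const-Factorisation semigroup s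

-- Chains as tracks

vec-ext : ∀ {a} {A : Set a} {n} {xs ys : Vec A n} → (∀ i → lookup xs i ≡ lookup ys i) → xs ≡ ys
vec-ext {xs = xs} {ys} eq =
  trans (sym (tabulate∘lookup xs)) (trans (tabulate-cong eq) (tabulate∘lookup ys))

module _ {a} {A : Set a} where

  -- Marks are ignored; between codes of words this is the prefix order, by `≼⇒agrees` and
  -- `agrees⇒≼`.
  _agrees-with_ : (ℕ → Cell A) → (ℕ → Cell A) → Set a
  γ agrees-with γ′ = ∀ n a → proj₂ (γ n) ≡ just a → proj₂ (γ′ n) ≡ just a

  -- Every track codes a chain, so set quantifiers need no validity condition.
  Member : (ℕ → Cell A) → Pred (List A) a
  Member γ x = proj₁ (γ (length x)) ≡ true × code x agrees-with γ

  codeTail-mark : ∀ (w : List A) n → proj₁ (codeTail w n) ≡ true ⇔ suc n ≡ length w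
  codeTail-mark []          n       = mk⇔ (λ ()) (λ ())
  codeTail-mark (a ∷ [])    zero    = mk⇔ (λ _ → refl) (λ _ → refl)
  codeTail-mark (a ∷ b ∷ w) zero    = mk⇔ (λ ()) (λ ())
  codeTail-mark (a ∷ w)     (suc n) = let h = codeTail-mark w n in
    mk⇔ (cong suc ∘ to h) (from h ∘ ℕₚ.suc-injective)

  code-mark : ∀ (w : List A) n → proj₁ (code w n) ≡ true ⇔ n ≡ length w
  code-mark []      zero    = mk⇔ (λ _ → refl) (λ _ → refl)
  code-mark (a ∷ w) zero    = mk⇔ (λ ()) (λ ())
  code-mark w       (suc n) = codeTail-mark w n

  codeTail-∷ʳ : ∀ w (a : A) → codeTail (w ∷ʳ a) (length w) ≡ (true , just a)
  codeTail-∷ʳ []      a = refl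
  codeTail-∷ʳ (b ∷ w) a = codeTail-∷ʳ w a

  -- Only the last letter shares its cell with the mark.
  codeTail-∷ʳ⁻ : ∀ (x : List A) n {a} →
                 proj₁ (codeTail x n) ≡ true → proj₂ (codeTail x n) ≡ just a →
                 ∃[ w ] x ≡ w ∷ʳ a × length w ≡ n
  codeTail-∷ʳ⁻ (a ∷ [])    zero    m  refl = [] , refl , refl
  codeTail-∷ʳ⁻ (a ∷ b ∷ x) zero    () _
  codeTail-∷ʳ⁻ (a ∷ x)     (suc n) m  l with w , refl , refl ← codeTail-∷ʳ⁻ x n m l =
    a ∷ w , refl , refl

  code-∷ʳ⁻ : ∀ (x : List A) n {a} → proj₁ (code x n) ≡ true → proj₂ (code x n) ≡ just a →
             ∃[ w ] x ≡ w ∷ʳ a × suc (length w) ≡ n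
  code-∷ʳ⁻ x (suc n) m l with w , eq , refl ← codeTail-∷ʳ⁻ x n m l = w , eq , refl

  last-∷ʳ : ∀ w (a : A) → last (w ∷ʳ a) ≡ just a
  last-∷ʳ []          a = refl
  last-∷ʳ (b ∷ [])    a = refl
  last-∷ʳ (b ∷ c ∷ w) a = last-∷ʳ (c ∷ w) a

  last-∷ʳ⁻ : ∀ x {a : A} → last x ≡ just a → ∃[ w ] x ≡ w ∷ʳ a
  last-∷ʳ⁻ (a ∷ [])    refl = [] , refl
  last-∷ʳ⁻ (a ∷ b ∷ x) l with w , eq ← last-∷ʳ⁻ (b ∷ x) l = a ∷ w , cong (a ∷_) eq

  length-∷ʳ⁻ : ∀ v w (a b : A) → length (v ∷ʳ a) ≡ length (w ∷ʳ b) → length v ≡ length w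
  length-∷ʳ⁻ v w a b eq = ℕₚ.suc-injective
    (trans (sym (length-∷ʳ v a)) (trans eq (length-∷ʳ w b)))
    where
    length-∷ʳ : ∀ v a → length (v ∷ʳ a) ≡ suc (length v)
    length-∷ʳ v a = trans (length-++ v) (ℕₚ.+-comm (length v) 1)

  ≼⇒agrees : ∀ {x y : List A} → x ≼ y → code x agrees-with code y
  ≼⇒agrees p (suc n) a eq = go p n a eq
    where
    go : ∀ {x y : List A} → x ≼ y → codeTail x agrees-with codeTail y
    go (refl ∷ p) zero    a eq = eq
    go (refl ∷ p) (suc n) a eq = go p n a eq

  agrees⇒≼ : ∀ {x y : List A} → code x agrees-with code y → x ≼ y
  agrees⇒≼ {x} {y} h = go x y (h ∘ suc)
    where
    go : ∀ x y → codeTail x agrees-with codeTail y → x ≼ y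
    go []      y       h = []
    go (a ∷ x) []      h with () ← h 0 a refl
    go (a ∷ x) (b ∷ y) h = sym (just-injective (h 0 a refl)) ∷ go x y (h ∘ suc)

  -- Both words read their letters off the same track, so they coincide until the shorter one ends.
  agrees⇒comparable : ∀ γ x y → code x agrees-with γ → code y agrees-with γ → x ≼ y ⊎ y ≼ x
  agrees⇒comparable γ x y h k = go (γ ∘ suc) x y (h ∘ suc) (k ∘ suc)
    where
    go : ∀ γ x y → codeTail x agrees-with γ → codeTail y agrees-with γ → x ≼ y ⊎ y ≼ x
    go γ []      y       h k = inj₁ []
    go γ (a ∷ x) []      h k = inj₂ []
    go γ (a ∷ x) (b ∷ y) h k
      with refl ← trans (sym (h 0 a refl)) (k 0 b refl)
      = Sum.map (refl ∷_) (refl ∷_) (go (γ ∘ suc) x y (h ∘ suc) (k ∘ suc))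

  ≼-length⇒≡ : ∀ {x y : List A} → x ≼ y → length x ≡ length y → x ≡ y
  ≼-length⇒≡ {y = []}    []         eq = refl
  ≼-length⇒≡             (refl ∷ p) eq = cong (_ ∷_) (≼-length⇒≡ p (ℕₚ.suc-injective eq))

  module _ (em : ExcludedMiddle a) where

    -- The marks are the lengths of members. The letter at `n` is taken from any member that has one
    -- there; for a chain all such members give the same letter.
    chainCode : Pred (List A) a → ℕ → Cell A
    chainCode X n = does (em {∃[ x ] X x × n ≡ length x}) , letter
      where
      letter : Maybe A
      letter with em {∃[ a ] ∃[ x ] X x × proj₂ (code x n) ≡ just a}
      ... | yes (a , _) = just a
      ... | no  _       = nothing

    module _ {X : Pred (List A) a} (chain : ∀ x y → X x → X y → x ≼ y ⊎ y ≼ x) where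

      X⇒Member : ∀ {x} → X x → Member (chainCode X) x
      X⇒Member {x} Xx = marked , agrees
        where
        marked : proj₁ (chainCode X (length x)) ≡ true
        marked with em {∃[ y ] X y × length x ≡ length y}
        ... | yes _ = refl
        ... | no ¬p = contradiction (x , Xx , refl) ¬p
        agrees : code x agrees-with chainCode X
        agrees n a eq with em {∃[ a ] ∃[ y ] X y × proj₂ (code y n) ≡ just a}
        ... | no ¬p = contradiction (a , x , Xx , eq) ¬p
        -- The stored letter `b` may come from another member `y`; comparability of `x` and `y`
        -- forces `b` to equal `a`.
        ... | yes (b , y , Xy , eq′) with chain x y Xx Xy
        ...   | inj₁ x≼y = trans (sym eq′) (≼⇒agrees x≼y n a eq)
        ...   | inj₂ y≼x = trans (sym (≼⇒agrees y≼x n b eq′)) eq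

      -- The mark yields a member `y` of `X` as long as `x`. Both follow the track, hence are
      -- comparable, and equal length makes them equal.
      Member⇒X : ∀ {x} → Member (chainCode X) x → X x
      Member⇒X {x} (marked , agrees) with em {∃[ y ] X y × length x ≡ length y}
      ... | yes (y , Xy , len) with agrees⇒comparable (chainCode X) x y agrees (proj₂ (X⇒Member Xy))
      ...   | inj₁ x≼y = subst X (sym (≼-length⇒≡ x≼y len)) Xy
      ...   | inj₂ y≼x = subst X (≼-length⇒≡ y≼x (sym len)) Xy
      Member⇒X {x} (() , agrees) | no _

-- From chain logic to track formulas

module _ {σ : Signature} where

  _⊃_ : ∀ {t} → LetterFormula σ t → LetterFormula σ t → LetterFormula σ t
  D ⊃ E = not (D ∧ not E)

  -- The condition at one position for track `i` to agree with track `j`.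
  _⊑ᴸ_ : ∀ {t} → Fin t → Fin t → LetterFormula σ t
  i ⊑ᴸ j = (i ≈ i) ⊃ (i ≈ j)

  somewhere : ∀ {t} → LetterFormula σ t → TrackFormula σ t
  somewhere D = not (everywhere (not D))

  -- Element and set variables are both interpreted by tracks; e and s say which.
  translate : ∀ {n k t} → MSO (wordSig σ) n k → Vec (Fin t) n → Vec (Fin t) k → TrackFormula σ t
  -- Each code of a word has exactly one mark, so one implication already makes the marks coincide.
  translate (atom eqLength (i ∷ j ∷ [])) e s = everywhere (mark (lookup e i) ⊃ mark (lookup e j))
  translate (atom prefix (i ∷ j ∷ []))   e s = everywhere (lookup e i ⊑ᴸ lookup e j)
  -- A position with both marks and a common letter must be the last letter of both words, which
  -- forces equal lengths.
  translate (atom lastEq (i ∷ j ∷ []))   e s =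
    somewhere ((mark (lookup e i) ∧ mark (lookup e j)) ∧ lookup e i ≈ lookup e j)
  translate (atom (lastRel R) is)        e s =
    let js = map (lookup e) is in somewhere (⋀ (λ l → mark (lookup js l)) ∧ rel R js)
  translate (i ≐ j)  e s =
    everywhere (lookup e i ⊑ᴸ lookup e j) ∧ everywhere (lookup e j ⊑ᴸ lookup e i)
  translate (i ∈ˢ j) e s =
    everywhere (mark (lookup e i) ⊃ mark (lookup s j)) ∧ everywhere (lookup e i ⊑ᴸ lookup s j)
  translate false    e s = everywhere false
  translate (not φ)  e s = not (translate φ e s)
  translate (φ ∧ ψ)  e s = translate φ e s ∧ translate ψ e s
  translate (φ ∨ ψ)  e s = not (not (translate φ e s) ∧ not (translate ψ e s))
  translate (φ ⇒ ψ)  e s = not (translate φ e s ∧ not (translate ψ e s))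
  -- The conjunct `word zero` restricts the new track to codes of words.
  translate (all₁ φ) e s = not (ex (word zero ∧ not (translate φ (zero ∷ map suc e) (map suc s))))
  translate (ex₁ φ)  e s = ex (word zero ∧ translate φ (zero ∷ map suc e) (map suc s))
  translate (all₂ φ) e s = not (ex (not (translate φ (map suc e) (zero ∷ map suc s))))
  translate (ex₂ φ)  e s = ex (translate φ (map suc e) (zero ∷ map suc s))

-- Correctness of the translation from chain logic.

module _ {σ : Signature} {ℓ : Level} (𝔐 : Structure σ ℓ) (em : ExcludedMiddle ℓ) where
  open Structure 𝔐 renaming (rel to ⟦_⟧)
  open OrderedStructure (𝒮 𝔐) using () renaming (rel to ⟦_⟧ˢ)

  ¬¬-elim : {P : Set ℓ} → ¬ ¬ P → P
  ¬¬-elim = decidable-stable em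

  SatL-⊃ : ∀ {t} (v : Vec (Cell Carrier) t) D E → SatL 𝔐 v (D ⊃ E) ⇔ (SatL 𝔐 v D → SatL 𝔐 v E)
  SatL-⊃ v D E = mk⇔ (λ h d → ¬¬-elim λ ¬e → h (d , ¬e)) (λ { h (d , ¬e) → ¬e (h d) })

  track : ∀ {t} → Tracks 𝔐 t → Fin t → ℕ → Cell Carrier
  track α i n = lookup (α n) i

  module _ {t} (α : Tracks 𝔐 t) where

    SatT-somewhere : ∀ D → SatT 𝔐 α (somewhere D) ⇔ (∃[ n ] SatL 𝔐 (α n) D)
    SatT-somewhere D = mk⇔
      (λ h → ¬¬-elim λ none → h (λ n d → none (n , d)))
      (λ { (n , d) h → h n d })

    SatT-⊑ᴸ : ∀ i j → SatT 𝔐 α (everywhere (i ⊑ᴸ j)) ⇔ (track α i agrees-with track α j)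
    SatT-⊑ᴸ i j = mk⇔
      (λ h n a eq → let b , eq₁ , eq₂ = to (SatL-⊃ (α n) (i ≈ i) (i ≈ j)) (h n) (a , eq , eq) in
                    trans eq₂ (trans (sym eq₁) eq))
      (λ h n → from (SatL-⊃ (α n) (i ≈ i) (i ≈ j)) λ { (a , eq , _) → a , eq , h n a eq })

    record Codes (i : Fin t) (x : List Carrier) : Set ℓ where
      constructor codes
      field
        cell : ∀ n → track α i n ≡ code x n

  open Codes

  module _ {t} {α : Tracks 𝔐 t} where

    module _ {i x} (x-coded : Codes α i x) where

      SatL-mark : ∀ n → SatL 𝔐 (α n) (mark i) ⇔ n ≡ length x
      SatL-mark n rewrite cell x-coded n =
        mk⇔ (to (code-mark x n) ∘ lower) (lift ∘ from (code-mark x n))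

      SatT-mark-⊃ : ∀ j → SatT 𝔐 α (everywhere (mark i ⊃ mark j)) ⇔
                          proj₁ (track α j (length x)) ≡ true
      SatT-mark-⊃ j = mk⇔
        (λ h → lower (to (SatL-⊃ (α (length x)) (mark i) (mark j)) (h (length x))
                        (from (SatL-mark _) refl)))
        (λ eq n → from (SatL-⊃ (α n) (mark i) (mark j)) λ m →
          lift (subst (λ l → proj₁ (track α j l) ≡ true) (sym (to (SatL-mark n) m)) eq))

      SatT-⊑ᴸ-coded : ∀ j → SatT 𝔐 α (everywhere (i ⊑ᴸ j)) ⇔ (code x agrees-with track α j)
      SatT-⊑ᴸ-coded j = mk⇔
        (λ h n a eq → h n a (trans (cong proj₂ (cell x-coded n)) eq))
        (λ h n a eq → h n a (trans (cong proj₂ (sym (cell x-coded n))) eq))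
        ⇔-∘ SatT-⊑ᴸ α i j

    module _ {x y i j} (x-coded : Codes α i x) (y-coded : Codes α j y) where

      eqLength-⇔ : length x ≡ length y ⇔ SatT 𝔐 α (everywhere (mark i ⊃ mark j))
      eqLength-⇔ = ⇔-sym (SatT-mark-⊃ x-coded j) ⇔-∘ mk⇔
        (λ eq → trans (cong proj₁ (cell y-coded _)) (from (code-mark y _) eq))
        (λ m → to (code-mark y _) (trans (cong proj₁ (sym (cell y-coded _))) m))

      prefix-⇔ : x ≼ y ⇔ SatT 𝔐 α (everywhere (i ⊑ᴸ j))
      prefix-⇔ = ⇔-sym (SatT-⊑ᴸ-coded x-coded j) ⇔-∘ mk⇔
        (λ x≼y n a eq → trans (cong proj₂ (cell y-coded n)) (≼⇒agrees x≼y n a eq))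
        (λ h → agrees⇒≼ (λ n a eq → trans (cong proj₂ (sym (cell y-coded n))) (h n a eq)))

      lastEq-⇔ : ⟦ lastEq ⟧ˢ (x ∷ y ∷ []) ⇔ SatT 𝔐 α (somewhere ((mark i ∧ mark j) ∧ i ≈ j))
      lastEq-⇔ = ⇔-sym (SatT-somewhere α ((mark i ∧ mark j) ∧ i ≈ j)) ⇔-∘ mk⇔ ltr rtl
        where
        ltr : ⟦ lastEq ⟧ˢ (x ∷ y ∷ []) → ∃[ n ] SatL 𝔐 (α n) ((mark i ∧ mark j) ∧ i ≈ j)
        ltr (len , a , lx , ly)
          with v , refl ← last-∷ʳ⁻ x lx | w , refl ← last-∷ʳ⁻ y ly
          -- Codes are shifted by one, so the letter after `v` sits at this position.
          = suc (length v)
          , (lift (cong proj₁ x-last) , lift (cong proj₁ y-last))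
          , a , cong proj₂ x-last , cong proj₂ y-last
          where
          x-last = trans (cell x-coded _) (codeTail-∷ʳ v a)
          y-last : track α j (suc (length v)) ≡ (true , just a)
          y-last rewrite length-∷ʳ⁻ v w a a len = trans (cell y-coded _) (codeTail-∷ʳ w a)
        rtl : ∃[ n ] SatL 𝔐 (α n) ((mark i ∧ mark j) ∧ i ≈ j) → ⟦ lastEq ⟧ˢ (x ∷ y ∷ [])
        rtl (n , (mx , my) , a , lx , ly)
          rewrite cell x-coded n | cell y-coded n
          with v , refl , _ ← code-∷ʳ⁻ x n (lower mx) lx | w , refl , _ ← code-∷ʳ⁻ y n (lower my) ly
          = trans (sym (to (code-mark _ n) (lower mx))) (to (code-mark _ n) (lower my))
          , a , last-∷ʳ v a , last-∷ʳ w a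

    module _ (R : Symbol σ) {xs : Vec (List Carrier) (arity σ R)} (js : Vec (Fin t) (arity σ R))
             (xs-coded : ∀ l → Codes α (lookup js l) (lookup xs l)) where

      lastRel-⇔ : ⟦ lastRel R ⟧ˢ xs ⇔ SatT 𝔐 α (somewhere (⋀ (λ l → mark (lookup js l)) ∧ rel R js))
      lastRel-⇔ = ⇔-sym (SatT-somewhere α (⋀ (λ l → mark (lookup js l)) ∧ rel R js)) ⇔-∘ mk⇔ ltr rtl
        where
        common : ∀ {r} (ws : Vec (List Carrier) r) →
                 (∀ i j → length (lookup ws i) ≡ length (lookup ws j)) →
                 ∃[ n ] ∀ i → length (lookup ws i) ≡ n
        -- For a nullary relation there is no word to supply a length, and `0` serves as a default.
        common []       h = 0 , λ ()
        common (w ∷ ws) h = length w , λ i → h i zero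

        ltr : ⟦ lastRel R ⟧ˢ xs → ∃[ n ] SatL 𝔐 (α n) (⋀ (λ l → mark (lookup js l)) ∧ rel R js)
        ltr (ws , as , len , eq , r) with n , len≡ ← common ws len
          = suc n
          , from (SatL-⋀ 𝔐 _) (λ l → lift (cong proj₁ (at l)))
          , as
          , vec-ext (λ l → trans (lookup-map l _ js)
                             (trans (cong proj₂ (at l)) (sym (lookup-map l just as))))
          , r
          where
          at : ∀ l → track α (lookup js l) (suc n) ≡ (true , just (lookup as l))
          at l = begin
            track α (lookup js l) (suc n)     ≡⟨ cell (xs-coded l) (suc n) ⟩
            codeTail (lookup xs l) n          ≡⟨ cong (λ v → codeTail (lookup v l) n) eq ⟩
            codeTail (lookup (zipWith _∷ʳ_ ws as) l) n
              ≡⟨ cong₂ codeTail (lookup-zipWith _∷ʳ_ l ws as) (sym (len≡ l)) ⟩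
            codeTail (lookup ws l ∷ʳ lookup as l) (length (lookup ws l))
              ≡⟨ codeTail-∷ʳ (lookup ws l) (lookup as l) ⟩
            (true , just (lookup as l))       ∎
            where open ≡-Reasoning

        rtl : ∃[ n ] SatL 𝔐 (α n) (⋀ (λ l → mark (lookup js l)) ∧ rel R js) → ⟦ lastRel R ⟧ˢ xs
        rtl (n , marks , as , eq , r)
          = ws , as
          , (λ l l′ → ℕₚ.suc-injective (trans (len l) (sym (len l′))))
          , vec-ext (λ l → trans (proj₁ (proj₂ (split l)))
              (trans (cong (_∷ʳ lookup as l) (sym (lookup∘tabulate _ l)))
                     (sym (lookup-zipWith _∷ʳ_ l ws as))))
          , r
          where
          split : ∀ l → ∃[ w ] lookup xs l ≡ w ∷ʳ lookup as l × suc (length w) ≡ n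
          split l = code-∷ʳ⁻ (lookup xs l) n
            (trans (cong proj₁ (sym (cell (xs-coded l) n))) (lower (to (SatL-⋀ 𝔐 _) marks l)))
            (trans (cong proj₂ (sym (cell (xs-coded l) n)))
              (trans (sym (lookup-map l _ js))
                     (trans (cong (λ v → lookup v l) eq) (lookup-map l just as))))
          ws : Vec (List Carrier) (arity σ R)
          ws = tabulate (proj₁ ∘ split)
          len : ∀ l → suc (length (lookup ws l)) ≡ n
          len l = trans (cong (suc ∘ length) (lookup∘tabulate _ l)) (proj₂ (proj₂ (split l)))

  -- The invariant of the translation. A set variable matches its track up to having the same
  -- members, so different tracks may represent one chain.
  record Coded {t n k} (α : Tracks 𝔐 t) (e : Vec (Fin t) n) (s : Vec (Fin t) k)
               (ρ : Vec (List Carrier) n) (η : Vec (Pred (List Carrier) ℓ) k) : Set ℓ where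
    field
      words : ∀ i → Codes α (lookup e i) (lookup ρ i)
      sets  : ∀ j x → lookup η j x ⇔ Member (track α (lookup s j)) x

  open Coded

  module _ {t n k} {α : Tracks 𝔐 t} {e : Vec (Fin t) n} {s : Vec (Fin t) k}
           {ρ : Vec (List Carrier) n} {η : Vec (Pred (List Carrier) ℓ) k}
           (c : Coded α e s ρ η) where

    old-word : ∀ {γ} i → Codes (_∷ᵗ_ 𝔐 γ α) (lookup (map suc e) i) (lookup ρ i)
    old-word i rewrite lookup-map i Fin.suc e = codes (cell (words c i))

    old-set : ∀ {γ} j x → lookup η j x ⇔ Member (track (_∷ᵗ_ 𝔐 γ α) (lookup (map suc s) j)) x
    old-set j x rewrite lookup-map j Fin.suc s = sets c j x

    add-word : ∀ {γ w} → (∀ n → γ n ≡ code w n) →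
               Coded (_∷ᵗ_ 𝔐 γ α) (zero ∷ map suc e) (map suc s) (w ∷ ρ) η
    add-word h = record
      { words = λ { zero → codes h ; (suc i) → old-word i }
      ; sets  = old-set
      }

    add-set : ∀ γ {X} → (∀ x → X x ⇔ Member γ x) →
              Coded (_∷ᵗ_ 𝔐 γ α) (map suc e) (zero ∷ map suc s) ρ (X ∷ η)
    add-set γ h = record
      { words = old-word
      ; sets  = λ { zero → h ; (suc j) → old-set j }
      }

  Member-chain : ∀ γ → OrderedStructure.IsChain (𝒮 𝔐) (Member γ)
  Member-chain γ x y (_ , hx) (_ , hy) = agrees⇒comparable γ x y hx hy

  lift-⇔ : ∀ {P : Set ℓ} {q} {Q : Set q} → P ⇔ Q → Lift (Level.suc ℓ) P ⇔ Q
  lift-⇔ h = mk⇔ (to h ∘ lower) (lift ∘ from h)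

  -- Induction on the formula. Words and tracks correspond through `code`, chains and tracks through
  -- `chainCode` and `Member`; excluded middle undoes the double negations by which disjunction,
  -- implication and universal quantifiers are encoded.
  translate-correct : ∀ {n k t} (φ : MSO (wordSig σ) n k)
    {α : Tracks 𝔐 t} {e : Vec (Fin t) n} {s : Vec (Fin t) k} {ρ η} → Coded α e s ρ η →
    SatCh (𝒮 𝔐) ρ η φ ⇔ SatT 𝔐 α (translate φ e s)
  translate-correct (atom eqLength (i ∷ j ∷ [])) c =
    lift-⇔ (eqLength-⇔ (words c i) (words c j) ⇔-∘ mk⇔ lower lift)
  translate-correct (atom prefix (i ∷ j ∷ []))   c = lift-⇔ (prefix-⇔ (words c i) (words c j))
  translate-correct (atom lastEq (i ∷ j ∷ []))   c = lift-⇔ (lastEq-⇔ (words c i) (words c j))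
  translate-correct (atom (lastRel R) is) {α} {e} {ρ = ρ} c =
    lift-⇔ (lastRel-⇔ R (map (lookup e) is) coded)
    where
    coded : ∀ l → Codes α (lookup (map (lookup e) is) l) (lookup (map (lookup ρ) is) l)
    coded l rewrite lookup-map l (lookup e) is | lookup-map l (lookup ρ) is = words c (lookup is l)
  translate-correct (i ≐ j) {ρ = ρ} c = lift-⇔ (mk⇔
    (λ eq → let open IsPartialOrder ≼-partialOrder in
            to (prefix-⇔ (words c i) (words c j)) (reflexive eq) ,
            to (prefix-⇔ (words c j) (words c i)) (reflexive (sym eq)))
    (λ { (p , q) → IsPartialOrder.antisym ≼-partialOrder
           (from (prefix-⇔ (words c i) (words c j)) p)
           (from (prefix-⇔ (words c j) (words c i)) q) }))
  translate-correct (i ∈ˢ j) {s = s} {ρ} c = lift-⇔ (mk⇔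
    (Product.map (from (SatT-mark-⊃ (words c i) (lookup s j)))
                 (from (SatT-⊑ᴸ-coded (words c i) (lookup s j))))
    (Product.map (to (SatT-mark-⊃ (words c i) (lookup s j)))
                 (to (SatT-⊑ᴸ-coded (words c i) (lookup s j))))
    ⇔-∘ sets c j (lookup ρ i))
  translate-correct false    c = mk⇔ (λ ()) (λ h → ⊥-elim (h 0))
  translate-correct (not φ)  c = let h = translate-correct φ c in mk⇔ (_∘ from h) (_∘ to h)
  translate-correct (φ ∧ ψ)  c = let h = translate-correct φ c ; k = translate-correct ψ c in
    mk⇔ (Product.map (to h) (to k)) (Product.map (from h) (from k))
  translate-correct (φ ∨ ψ)  c = let h = translate-correct φ c ; k = translate-correct ψ c in mk⇔
    (λ { (inj₁ p) (¬p , _) → ¬p (to h p) ; (inj₂ q) (_ , ¬q) → ¬q (to k q) })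
    (λ ¬¬ → Sum.map (from h) (from k) (¬¬-elim λ none → ¬¬ (none ∘ inj₁ , none ∘ inj₂)))
  translate-correct (φ ⇒ ψ)  c = let h = translate-correct φ c ; k = translate-correct ψ c in mk⇔
    (λ { imp (p , ¬q) → ¬q (to k (imp (from h p))) })
    (λ ¬¬ p → from k (¬¬-elim λ ¬q → ¬¬ (to h p , ¬q)))
  translate-correct (all₁ φ) c = mk⇔
    (λ { h (γ , (w , γ≡) , ¬p) → ¬p (to (translate-correct φ (add-word c γ≡)) (h w)) })
    (λ none w → from (translate-correct φ (add-word c (λ _ → refl)))
      (¬¬-elim λ ¬p → none (code w , (w , λ _ → refl) , ¬p)))
  translate-correct (ex₁ φ)  c = mk⇔
    (λ { (w , p) → code w , (w , λ _ → refl) ,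
                   to (translate-correct φ (add-word c (λ _ → refl))) p })
    (λ { (γ , (w , γ≡) , p) → w , from (translate-correct φ (add-word c γ≡)) p })
  translate-correct (all₂ φ) c = mk⇔
    (λ { h (γ , ¬p) → ¬p (to (translate-correct φ (add-set c γ (λ _ → mk⇔ id id)))
                            (h (Member γ) (Member-chain γ))) })
    (λ none X chain → from (translate-correct φ
        (add-set c (chainCode em X) (λ _ → mk⇔ (X⇒Member em chain) (Member⇒X em chain))))
      (¬¬-elim λ ¬p → none (chainCode em X , ¬p)))
  translate-correct (ex₂ φ)  c = mk⇔
    (λ { (X , chain , p) → chainCode em X , to (translate-correct φ
           (add-set c (chainCode em X) (λ _ → mk⇔ (X⇒Member em chain) (Member⇒X em chain)))) p })
    (λ { (γ , p) → Member γ , Member-chain γ ,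
                   from (translate-correct φ (add-set c γ (λ _ → mk⇔ id id))) p })

theorem5p2 : (ℓ : Level) (m : ℕ) (ar : Fin m → ℕ) →
    Σ[ f ∈ (MSOSentence (wordSig (relSig m ar)) → FOSentence (relSig m ar)) ]
    (ExcludedMiddle (Level.suc ℓ) →
    (𝔐 : Structure (relSig m ar) ℓ) (φ : MSOSentence (wordSig (relSig m ar))) →
    φ ∈ MSOChTheory (𝒮 𝔐) ⇔ f φ ∈ FOTheory 𝔐)
-- The reduction is constructed before excluded middle is assumed, so it is a computable function of
-- the sentence. In the correctness proof the assumption is lowered to level `ℓ` through `Lift`.
theorem5p2 ℓ m ar = (λ φ → sentence (translate φ [] [])) , λ em 𝔐 φ →
  let em′ = λ {P} → map′ lower lift (em {Lift _ P}) in
  sentence-correct (translate φ [] []) 𝔐 em′ ⇔-∘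
  translate-correct 𝔐 em′ φ (record { words = λ () ; sets = λ () })
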